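{- Let $F$ be a simple graph of order $n\ge 1$, let $V_k=\{v_1,\ldots,v_k\}\subseteq V(F)$ with $|V_k|=k$, and let $H_v$ be a simple graph of order $m\ge 2$ with a specified vertex $v$ of degree $m-1$. Put $H_1=H_v-v$ and $G=G[F,V_k,H_v]$. Order the vertices of $F$ so that $v_1,\ldots,v_k$ come first. Then the characteristic polynomial of the adjacency matrix of $G$ is $$f_{A(G)}(x)=\bigl(f_{A(H_1)}(x)\bigr)^k\det(xI_n-M),\qquad M=A(F)+\Gamma_{A(H_1)}(x)\begin{pmatrix} I_k & 0\\ 0&0\end{pmatrix},$$ where the block matrix is $n\times n$.
   Context: All graphs are finite and simple. For a square matrix $N$ of order $s$, $f_N(x)=\det(xI_s-N)$ is its characteristic polynomial, and its coronal is $\Gamma_N(x)=\mathbf 1_s^T(xI_s-N)^{ -1}\mathbf 1_s$, a rational function of $x$, where $\mathbf 1_s$ is the all-ones column vector; the identity is an identity of rational functions in $x$. $A(\cdot)$ denotes the adjacency matrix. Graph with $k$ pockets: $G[F,V_k,H_v]$ is obtained by taking one copy of $F$ and $k$ vertex-disjoint copies of $H_v$, and, for each $i=1,\ldots,k$, identifying the vertex $v$ of the $i$th copy of $H_v$ with the vertex $v_i$ of $F$. -}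

module Defs where

open import Level using (Level; _⊔_)
open import Algebra.Bundles using (CommutativeRing)
import Algebra.Properties.Ring
import Algebra.Properties.Semiring.Exp
import Algebra.Properties.Semiring.Sum
import Algebra.Solver.Ring.NaturalCoefficients.Default
import Relation.Binary.Reasoning.Setoid
open import Data.Bool.Base using (Bool; true; false; _∧_; if_then_else_)
open import Data.Empty using (⊥-elim)
open import Data.Fin.Base using (Fin; zero; suc; toℕ; punchIn; splitAt; remQuot)
import Data.Fin.Properties as Fin
open import Data.Fin.Permutation using (Permutation′; _⟨$⟩ʳ_)
open import Data.Fin.Subset using (∣_∣)
open import Data.List.Base using (List; []; _∷_; map)
open import Data.Nat.Base as ℕ using (ℕ; zero; suc)
import Data.Nat.Properties as ℕ
open import Data.Product.Base using (Σ-syntax; ∃; _×_; _,_; proj₁; proj₂)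
open import Data.Rational.Base as ℚ using (ℚ; 0ℚ; 1ℚ)
import Data.Rational.Properties as ℚ
open import Data.Sum.Base using (_⊎_; inj₁; inj₂; map₂)
open import Data.Vec.Base using (tabulate)
open import Function.Base using (_∘_)
open import Relation.Binary.PropositionalEquality as ≡ using (_≡_)
open import Relation.Nullary using (¬_; Dec; yes; no; does)

private
  variable
    c ℓ : Level
    n k h : ℕ

record Graph (n : ℕ) : Set where
  field
    adj        : Fin n → Fin n → Bool
    adj-sym    : ∀ i j → adj i j ≡ adj j i
    adj-irrefl : ∀ i → adj i i ≡ false

open Graph public

degree : Graph n → Fin n → ℕ
degree G i = ∣ tabulate (adj G i) ∣

-- Position i of the new vertex order is occupied by the old vertex σ ⟨$⟩ʳ i.
reorder : Permutation′ n → Graph n → Graph n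
reorder σ G = record
  { adj        = λ i j → adj G (σ ⟨$⟩ʳ i) (σ ⟨$⟩ʳ j)
  ; adj-sym    = λ i j → adj-sym G (σ ⟨$⟩ʳ i) (σ ⟨$⟩ʳ j)
  ; adj-irrefl = λ i → adj-irrefl G (σ ⟨$⟩ʳ i)
  }

infixl 6 _─_

_─_ : Graph (suc h) → Fin (suc h) → Graph h
H ─ u = record
  { adj        = λ i j → adj H (punchIn u i) (punchIn u j)
  ; adj-sym    = λ i j → adj-sym H (punchIn u i) (punchIn u j)
  ; adj-irrefl = λ i → adj-irrefl H (punchIn u i)
  }

-- In G[F,V_k,H_u] the vertex u of the i-th copy of H is the vertex v i of F,
-- so a vertex is either a vertex of F or a pair (i , w), standing for the
-- vertex punchIn u w ≢ u of the i-th copy.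
module Pockets (F : Graph n) (v : Fin k → Fin n)
               (H : Graph (suc h)) (u : Fin (suc h)) where

  Vertex : Set
  Vertex = Fin n ⊎ (Fin k × Fin h)

  vertex : Fin (n ℕ.+ k ℕ.* h) → Vertex
  vertex = map₂ (remQuot h) ∘ splitAt n

  vadj : Vertex → Vertex → Bool
  vadj (inj₁ a)       (inj₁ b)       = adj F a b
  vadj (inj₁ a)       (inj₂ (i , w)) = does (a Fin.≟ v i) ∧ adj H u (punchIn u w)
  vadj (inj₂ (i , w)) (inj₁ a)       = does (a Fin.≟ v i) ∧ adj H (punchIn u w) u
  vadj (inj₂ (i , w)) (inj₂ (j , z)) = does (i Fin.≟ j) ∧ adj H (punchIn u w) (punchIn u z)

  private
    ≟-comm : (i j : Fin k) → does (i Fin.≟ j) ≡ does (j Fin.≟ i)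
    ≟-comm i j with i Fin.≟ j | j Fin.≟ i
    ... | yes _ | yes _ = ≡.refl
    ... | no  _ | no  _ = ≡.refl
    ... | yes p | no  q = ⊥-elim (q (≡.sym p))
    ... | no  p | yes q = ⊥-elim (p (≡.sym q))

    ∧-false : ∀ b {c} → c ≡ false → b ∧ c ≡ false
    ∧-false true  eq = eq
    ∧-false false eq = ≡.refl

  vadj-sym : ∀ x y → vadj x y ≡ vadj y x
  vadj-sym (inj₁ a)       (inj₁ b)       = adj-sym F a b
  vadj-sym (inj₁ a)       (inj₂ (i , w)) = ≡.cong (does (a Fin.≟ v i) ∧_) (adj-sym H u (punchIn u w))
  vadj-sym (inj₂ (i , w)) (inj₁ a)       = ≡.cong (does (a Fin.≟ v i) ∧_) (adj-sym H (punchIn u w) u)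
  vadj-sym (inj₂ (i , w)) (inj₂ (j , z)) =
    ≡.cong₂ _∧_ (≟-comm i j) (adj-sym H (punchIn u w) (punchIn u z))

  vadj-irrefl : ∀ x → vadj x x ≡ false
  vadj-irrefl (inj₁ a)       = adj-irrefl F a
  vadj-irrefl (inj₂ (i , w)) = ∧-false (does (i Fin.≟ i)) (adj-irrefl H (punchIn u w))

pockets : Graph n → (Fin k → Fin n) → Graph (suc h) → Fin (suc h) →
          Graph (n ℕ.+ k ℕ.* h)
pockets F v H u = record
  { adj        = λ a b → vadj (vertex a) (vertex b)
  ; adj-sym    = λ a b → vadj-sym (vertex a) (vertex b)
  ; adj-irrefl = λ a → vadj-irrefl (vertex a)
  }
  where open Pockets F v H u

module MatrixOver (K : CommutativeRing c ℓ) where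
  open CommutativeRing K hiding (zero)
  open Algebra.Properties.Semiring.Sum semiring public
  open Algebra.Properties.Semiring.Exp semiring public using (_^_)

  Matrix : ℕ → Set c
  Matrix n = Fin n → Fin n → Carrier

  infix 4 _≈ᴹ_
  _≈ᴹ_ : Matrix n → Matrix n → Set ℓ
  A ≈ᴹ B = ∀ i j → A i j ≈ B i j

  1ᴹ : Matrix n
  1ᴹ i j = if does (i Fin.≟ j) then 1# else 0#

  infixl 7 _*ᴹ_
  _*ᴹ_ : Matrix n → Matrix n → Matrix n
  (A *ᴹ B) i k = sum (λ j → A i j * B j k)

  record Inverse (A : Matrix n) : Set (c ⊔ ℓ) where
    field
      matrix   : Matrix n
      inverseˡ : matrix *ᴹ A ≈ᴹ 1ᴹ
      inverseʳ : A *ᴹ matrix ≈ᴹ 1ᴹ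

  -- Laplace expansion along the first row.
  det : Matrix n → Carrier
  det {zero}  A = 1#
  det {suc n} A =
    sum (λ j → (- 1#) ^ toℕ j * (A zero j * det (λ i l → A (suc i) (punchIn j l))))

  infixl 6 _I-_
  _I-_ : Carrier → Matrix n → Matrix n
  (x I- N) i j = x * 1ᴹ i j - N i j

  -- The n × n block matrix with I_k in the upper left corner and 0 elsewhere.
  blockI : ℕ → Matrix n
  blockI k i j = if does (toℕ i ℕ.<? k) then 1ᴹ i j else 0#

  -- (x I- P) is invertible if the entries of P lie in a subset O closed under
  -- sums and products and x - p has an inverse in O for every p in O: eliminate
  -- the first row and column; the Schur complement is again of this kind.
  module Resolvent {p} (x : Carrier) (O : Carrier → Set p)
    (O-+ : ∀ {a b} → O a → O b → O (a + b))
    (O-* : ∀ {a b} → O a → O b → O (a * b))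
    (pivot : ∀ a → O a → Σ[ y ∈ Carrier ] O y × x * y ≈ 1# + a * y) where

    private
      open Relation.Binary.Reasoning.Setoid setoid
      open Algebra.Solver.Ring.NaturalCoefficients.Default commutativeSemiring
        using (solve; _:+_; _:*_; _:=_)
      open Algebra.Properties.Ring ring using (-‿distribˡ-*; -1*x≈-x)

      sum-1ᴹˡ : (t : Fin n → Carrier) (i : Fin n) → sum (λ j → 1ᴹ i j * t j) ≈ t i
      sum-1ᴹˡ {suc n} t zero = begin
        1# * t zero + sum (λ j → 0# * t (suc j))  ≈⟨ +-congˡ (*-distribˡ-sum 0# (t ∘ suc)) ⟨
        1# * t zero + 0# * sum (t ∘ suc)          ≈⟨ +-cong (*-identityˡ _) (zeroˡ _) ⟩
        t zero + 0#                               ≈⟨ +-identityʳ _ ⟩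
        t zero                                    ∎
      sum-1ᴹˡ {suc n} t (suc i) = begin
        0# * t zero + sum (λ j → 1ᴹ i j * t (suc j))  ≈⟨ +-cong (zeroˡ _) (sum-1ᴹˡ (t ∘ suc) i) ⟩
        0# + t (suc i)                                ≈⟨ +-identityˡ _ ⟩
        t (suc i)                                     ∎

      1ᴹ-sym : (i j : Fin n) → 1ᴹ i j ≡ 1ᴹ j i
      1ᴹ-sym zero    zero    = ≡.refl
      1ᴹ-sym zero    (suc j) = ≡.refl
      1ᴹ-sym (suc i) zero    = ≡.refl
      1ᴹ-sym (suc i) (suc j) = 1ᴹ-sym i j

      sum-1ᴹʳ : (t : Fin n → Carrier) (i : Fin n) → sum (λ j → t j * 1ᴹ j i) ≈ t i
      sum-1ᴹʳ t i = trans
        (sum-cong-≋ λ j → trans (*-comm _ _) (*-congʳ (reflexive (1ᴹ-sym j i))))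
        (sum-1ᴹˡ t i)

      *ᴹ-assoc : (A B C : Matrix n) → (A *ᴹ B) *ᴹ C ≈ᴹ A *ᴹ (B *ᴹ C)
      *ᴹ-assoc A B C i l = begin
        sum (λ k → sum (λ j → A i j * B j k) * C k l)
          ≈⟨ sum-cong-≋ (λ k → *-distribʳ-sum (C k l) (λ j → A i j * B j k)) ⟩
        sum (λ k → sum (λ j → A i j * B j k * C k l))
          ≈⟨ ∑-comm (λ k j → A i j * B j k * C k l) ⟩
        sum (λ j → sum (λ k → A i j * B j k * C k l))
          ≈⟨ sum-cong-≋ (λ j → sum-cong-≋ λ k → *-assoc (A i j) (B j k) (C k l)) ⟩
        sum (λ j → sum (λ k → A i j * (B j k * C k l)))
          ≈⟨ sum-cong-≋ (λ j → *-distribˡ-sum (A i j) (λ k → B j k * C k l)) ⟨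
        sum (λ j → A i j * sum (λ k → B j k * C k l)) ∎

      -- x R = I + P R, that is (x I - P) R = I without subtraction.
      RightInverse : Matrix n → Matrix n → Set ℓ
      RightInverse P R = ∀ i k → x * R i k ≈ 1ᴹ i k + sum (λ j → P i j * R j k)

      rightInverse : (P : Matrix n) → (∀ i j → O (P i j)) → ∃ (RightInverse P)
      rightInverse {zero}  P OP = (λ ()) , (λ ())
      rightInverse {suc n} P OP = R , correct
        where
        p₀ : Carrier
        p₀ = P zero zero
        r b : Fin n → Carrier
        r j = P zero (suc j)
        b i = P (suc i) zero
        y : Carrier
        y = proj₁ (pivot p₀ (OP zero zero))
        Oy : O y
        Oy = proj₁ (proj₂ (pivot p₀ (OP zero zero)))
        xy : x * y ≈ 1# + p₀ * y
        xy = proj₂ (proj₂ (pivot p₀ (OP zero zero)))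
        S : Matrix n
        S i j = P (suc i) (suc j) + b i * y * r j
        T-rec : ∃ (RightInverse S)
        T-rec = rightInverse S λ i j → O-+ (OP _ _) (O-* (O-* (OP _ _) Oy) (OP _ _))
        T : Matrix n
        T = proj₁ T-rec
        u w : Fin n → Carrier
        u k = sum (λ l → r l * T l k)
        w i = sum (λ l → T i l * b l)
        s : Carrier
        s = sum (λ l → r l * w l)
        R : Matrix (suc n)
        R zero    zero    = y + y * s * y
        R zero    (suc k) = y * u k
        R (suc i) zero    = w i * y
        R (suc i) (suc k) = T i k

        T-eq : ∀ i k → x * T i k ≈
               1ᴹ i k + (sum (λ j → P (suc i) (suc j) * T j k) + b i * y * u k)
        T-eq i k = begin
          x * T i k
            ≈⟨ proj₂ T-rec i k ⟩
          1ᴹ i k + sum (λ j → (P (suc i) (suc j) + b i * y * r j) * T j k)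
            ≈⟨ +-congˡ (sum-cong-≋ λ j →
                 trans (distribʳ (T j k) (P (suc i) (suc j)) (b i * y * r j))
                       (+-congˡ (*-assoc (b i * y) (r j) (T j k)))) ⟩
          1ᴹ i k + sum (λ j → P (suc i) (suc j) * T j k + b i * y * (r j * T j k))
            ≈⟨ +-congˡ (∑-distrib-+ (λ j → P (suc i) (suc j) * T j k) _) ⟩
          1ᴹ i k + (sum (λ j → P (suc i) (suc j) * T j k) + sum (λ j → b i * y * (r j * T j k)))
            ≈⟨ +-congˡ (+-congˡ (*-distribˡ-sum (b i * y) (λ j → r j * T j k))) ⟨
          1ᴹ i k + (sum (λ j → P (suc i) (suc j) * T j k) + b i * y * u k) ∎

        -- For any row vector q, q (T b) = (q T) b.
        sum-w : (q : Fin n → Carrier) →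
                sum (λ j → q j * w j) ≈ sum (λ k → sum (λ j → q j * T j k) * b k)
        sum-w q = begin
          sum (λ j → q j * sum (λ k → T j k * b k))
            ≈⟨ sum-cong-≋ (λ j → *-distribˡ-sum (q j) (λ k → T j k * b k)) ⟩
          sum (λ j → sum (λ k → q j * (T j k * b k)))
            ≈⟨ ∑-comm (λ j k → q j * (T j k * b k)) ⟩
          sum (λ k → sum (λ j → q j * (T j k * b k)))
            ≈⟨ sum-cong-≋ (λ k → sum-cong-≋ λ j → *-assoc (q j) (T j k) (b k)) ⟨
          sum (λ k → sum (λ j → q j * T j k * b k))
            ≈⟨ sum-cong-≋ (λ k → *-distribʳ-sum (b k) (λ j → q j * T j k)) ⟨
          sum (λ k → sum (λ j → q j * T j k) * b k) ∎

        w-eq : ∀ i → x * w i ≈ b i + (sum (λ j → P (suc i) (suc j) * w j) + b i * y * s)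
        w-eq i = begin
          x * sum (λ k → T i k * b k)
            ≈⟨ *-distribˡ-sum x (λ k → T i k * b k) ⟩
          sum (λ k → x * (T i k * b k))
            ≈⟨ sum-cong-≋ (λ k → trans (sym (*-assoc _ _ _)) (*-congʳ (T-eq i k))) ⟩
          sum (λ k → (1ᴹ i k + (Q k + b i * y * u k)) * b k)
            ≈⟨ sum-cong-≋ (λ k → solve 5 (λ e q a u c → (e :+ (q :+ a :* u)) :* c
                 := e :* c :+ (q :* c :+ a :* (u :* c))) refl (1ᴹ i k) (Q k) (b i * y) (u k) (b k)) ⟩
          sum (λ k → 1ᴹ i k * b k + (Q k * b k + b i * y * (u k * b k)))
            ≈⟨ ∑-distrib-+ (λ k → 1ᴹ i k * b k) _ ⟩
          sum (λ k → 1ᴹ i k * b k) + sum (λ k → Q k * b k + b i * y * (u k * b k))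
            ≈⟨ +-cong (sum-1ᴹˡ b i) (∑-distrib-+ (λ k → Q k * b k) _) ⟩
          b i + (sum (λ k → Q k * b k) + sum (λ k → b i * y * (u k * b k)))
            ≈⟨ +-congˡ (+-congˡ (*-distribˡ-sum (b i * y) (λ k → u k * b k))) ⟨
          b i + (sum (λ k → Q k * b k) + b i * y * sum (λ k → u k * b k))
            ≈⟨ +-congˡ (+-cong (sum-w (λ j → P (suc i) (suc j))) (*-congˡ (sum-w r))) ⟨
          b i + (sum (λ j → P (suc i) (suc j) * w j) + b i * y * s) ∎
          where
          Q : Fin n → Carrier
          Q k = sum (λ j → P (suc i) (suc j) * T j k)

        sum-*y : (q : Fin n → Carrier) → sum (λ j → q j * (w j * y)) ≈ sum (λ j → q j * w j) * y
        sum-*y q = trans (sum-cong-≋ λ j → sym (*-assoc (q j) (w j) y))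
                         (sym (*-distribʳ-sum y (λ j → q j * w j)))

        correct : RightInverse P R
        correct zero zero = begin
          x * (y + y * s * y)
            ≈⟨ solve 3 (λ x y s → x :* (y :+ y :* s :* y) := x :* y :+ x :* y :* (s :* y)) refl x y s ⟩
          x * y + x * y * (s * y)
            ≈⟨ +-cong xy (*-congʳ xy) ⟩
          (1# + p₀ * y) + (1# + p₀ * y) * (s * y)
            ≈⟨ +-congˡ (trans (distribʳ _ _ _) (+-congʳ (*-identityˡ _))) ⟩
          (1# + p₀ * y) + (s * y + p₀ * y * (s * y))
            ≈⟨ solve 4 (λ e p y s → (e :+ p :* y) :+ (s :* y :+ p :* y :* (s :* y))
                 := e :+ (p :* (y :+ y :* s :* y) :+ s :* y)) refl 1# p₀ y s ⟩
          1# + (p₀ * (y + y * s * y) + s * y)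
            ≈⟨ +-congˡ (+-congˡ (sum-*y r)) ⟨
          1# + (p₀ * (y + y * s * y) + sum (λ j → r j * (w j * y))) ∎
        correct zero (suc k) = begin
          x * (y * u k)                   ≈⟨ *-assoc x y (u k) ⟨
          x * y * u k                     ≈⟨ *-congʳ xy ⟩
          (1# + p₀ * y) * u k             ≈⟨ trans (distribʳ _ _ _) (+-cong (*-identityˡ _) (*-assoc _ _ _)) ⟩
          u k + p₀ * (y * u k)            ≈⟨ +-comm _ _ ⟩
          p₀ * (y * u k) + u k            ≈⟨ +-identityˡ _ ⟨
          0# + (p₀ * (y * u k) + u k)     ∎
        correct (suc i) zero = begin
          x * (w i * y)
            ≈⟨ *-assoc x (w i) y ⟨
          x * w i * y
            ≈⟨ *-congʳ (w-eq i) ⟩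
          (b i + (V + b i * y * s)) * y
            ≈⟨ solve 4 (λ c V y s → (c :+ (V :+ c :* y :* s)) :* y
                 := c :* (y :+ y :* s :* y) :+ V :* y) refl (b i) V y s ⟩
          b i * (y + y * s * y) + V * y
            ≈⟨ +-congˡ (sum-*y (λ j → P (suc i) (suc j))) ⟨
          b i * (y + y * s * y) + sum (λ j → P (suc i) (suc j) * (w j * y))
            ≈⟨ +-identityˡ _ ⟨
          0# + (b i * (y + y * s * y) + sum (λ j → P (suc i) (suc j) * (w j * y))) ∎
          where
          V : Carrier
          V = sum (λ j → P (suc i) (suc j) * w j)
        correct (suc i) (suc k) = trans (T-eq i k)
          (+-congˡ (trans (+-comm _ _) (+-congʳ (*-assoc _ _ _))))

      fromRightInverse : (P R : Matrix n) → RightInverse P R → (x I- P) *ᴹ R ≈ᴹ 1ᴹ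
      fromRightInverse P R eq i k = begin
        sum (λ j → (x * 1ᴹ i j - P i j) * R j k)
          ≈⟨ sum-cong-≋ (λ j → trans (distribʳ (R j k) (x * 1ᴹ i j) (- P i j))
               (+-cong (*-assoc x (1ᴹ i j) (R j k))
                       (trans (sym (-‿distribˡ-* (P i j) (R j k)))
                              (sym (-1*x≈-x (P i j * R j k)))))) ⟩
        sum (λ j → x * (1ᴹ i j * R j k) + - 1# * (P i j * R j k))
          ≈⟨ ∑-distrib-+ (λ j → x * (1ᴹ i j * R j k)) _ ⟩
        sum (λ j → x * (1ᴹ i j * R j k)) + sum (λ j → - 1# * (P i j * R j k))
          ≈⟨ +-cong (*-distribˡ-sum x (λ j → 1ᴹ i j * R j k)) (*-distribˡ-sum (- 1#) (λ j → P i j * R j k)) ⟨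
        x * sum (λ j → 1ᴹ i j * R j k) + - 1# * PR
          ≈⟨ +-cong (*-congˡ (sum-1ᴹˡ (λ j → R j k) i))
                    (-1*x≈-x PR) ⟩
        x * R i k - PR
          ≈⟨ +-congʳ (eq i k) ⟩
        1ᴹ i k + PR - PR
          ≈⟨ +-assoc _ _ _ ⟩
        1ᴹ i k + (PR - PR)
          ≈⟨ +-congˡ (-‿inverseʳ PR) ⟩
        1ᴹ i k + 0#
          ≈⟨ +-identityʳ _ ⟩
        1ᴹ i k ∎
        where
        PR : Carrier
        PR = sum (λ j → P i j * R j k)

    -- A left inverse comes from a right inverse of the transpose.
    resolvent : (P : Matrix n) → (∀ i j → O (P i j)) → Inverse (x I- P)
    resolvent {n} P OP = record { matrix = R ; inverseˡ = RA ; inverseʳ = AR }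
      where
      A R R′ L : Matrix n
      A  = x I- P
      R  = proj₁ (rightInverse P OP)
      R′ = proj₁ (rightInverse (λ i j → P j i) (λ i j → OP j i))
      L  i j = R′ j i

      AR : A *ᴹ R ≈ᴹ 1ᴹ
      AR = fromRightInverse P R (proj₂ (rightInverse P OP))

      LA : L *ᴹ A ≈ᴹ 1ᴹ
      LA i k = begin
        sum (λ j → R′ j i * (x * 1ᴹ j k - P j k))
          ≈⟨ sum-cong-≋ (λ j → trans (*-comm _ _)
               (*-congʳ (+-congʳ (*-congˡ (reflexive (1ᴹ-sym j k)))))) ⟩
        sum (λ j → (x * 1ᴹ k j - P j k) * R′ j i)
          ≈⟨ fromRightInverse (λ i j → P j i) R′
               (proj₂ (rightInverse (λ i j → P j i) (λ i j → OP j i))) k i ⟩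
        1ᴹ k i  ≡⟨ 1ᴹ-sym k i ⟩
        1ᴹ i k  ∎

      R≈L : R ≈ᴹ L
      R≈L i k = begin
        R i k                          ≈⟨ sum-1ᴹˡ (λ j → R j k) i ⟨
        sum (λ j → 1ᴹ i j * R j k)     ≈⟨ sum-cong-≋ (λ j → *-congʳ (LA i j)) ⟨
        ((L *ᴹ A) *ᴹ R) i k            ≈⟨ *ᴹ-assoc L A R i k ⟩
        (L *ᴹ (A *ᴹ R)) i k            ≈⟨ sum-cong-≋ (λ j → *-congˡ (AR j k)) ⟩
        sum (λ j → L i j * 1ᴹ j k)     ≈⟨ sum-1ᴹʳ (λ j → L i j) k ⟩
        L i k                          ∎

      RA : R *ᴹ A ≈ᴹ 1ᴹ
      RA i k = trans (sum-cong-≋ λ j → *-congʳ (R≈L i j)) (LA i k)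

-- A polynomial is a list of coefficients, lowest degree first; equality is
-- coefficientwise, so trailing zeros are irrelevant.

module Polynomial (R : CommutativeRing c ℓ) where
  open CommutativeRing R hiding (zero)
  open Algebra.Properties.Ring ring using (-0#≈0#)

  Poly : Set c
  Poly = List Carrier

  coeff : Poly → ℕ → Carrier
  coeff []      i       = 0#
  coeff (a ∷ p) zero    = a
  coeff (a ∷ p) (suc i) = coeff p i

  infix 4 _≈ᴾ_
  record _≈ᴾ_ (p q : Poly) : Set ℓ where
    constructor coeffwise
    field at : ∀ i → coeff p i ≈ coeff q i
  open _≈ᴾ_ public

  infixl 6 _+ᴾ_
  infixl 7 _*ᴾ_ _·_

  _+ᴾ_ : Poly → Poly → Poly
  []      +ᴾ q       = q
  (a ∷ p) +ᴾ []      = a ∷ p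
  (a ∷ p) +ᴾ (b ∷ q) = (a + b) ∷ (p +ᴾ q)

  _·_ : Carrier → Poly → Poly
  a · p = map (a *_) p

  _*ᴾ_ : Poly → Poly → Poly
  []      *ᴾ q = []
  (a ∷ p) *ᴾ q = a · q +ᴾ (0# ∷ p *ᴾ q)

  -ᴾ_ : Poly → Poly
  -ᴾ_ = map (-_)

  const : Carrier → Poly
  const a = a ∷ []

  X : Poly
  X = 0# ∷ 1# ∷ []

  private
    module R-Reasoning = Relation.Binary.Reasoning.Setoid setoid
    open Algebra.Solver.Ring.NaturalCoefficients.Default commutativeSemiring
      using (solve; _:+_; _:*_; _:=_)

  coeff-+ : ∀ p q i → coeff (p +ᴾ q) i ≈ coeff p i + coeff q i
  coeff-+ []      q       i       = sym (+-identityˡ _)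
  coeff-+ (a ∷ p) []      i       = sym (+-identityʳ _)
  coeff-+ (a ∷ p) (b ∷ q) zero    = refl
  coeff-+ (a ∷ p) (b ∷ q) (suc i) = coeff-+ p q i

  coeff-· : ∀ a p i → coeff (a · p) i ≈ a * coeff p i
  coeff-· a []      i       = sym (zeroʳ a)
  coeff-· a (b ∷ p) zero    = refl
  coeff-· a (b ∷ p) (suc i) = coeff-· a p i

  coeff-neg : ∀ p i → coeff (-ᴾ p) i ≈ - coeff p i
  coeff-neg []      i       = sym -0#≈0#
  coeff-neg (b ∷ p) zero    = refl
  coeff-neg (b ∷ p) (suc i) = coeff-neg p i

  coeff-*-zero : ∀ a p q → coeff ((a ∷ p) *ᴾ q) 0 ≈ a * coeff q 0
  coeff-*-zero a p q = trans (coeff-+ (a · q) _ 0) (trans (+-identityʳ _) (coeff-· a q 0))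

  coeff-*-suc : ∀ a p q i →
    coeff ((a ∷ p) *ᴾ q) (suc i) ≈ a * coeff q (suc i) + coeff (p *ᴾ q) i
  coeff-*-suc a p q i = trans (coeff-+ (a · q) _ (suc i)) (+-congʳ (coeff-· a q (suc i)))

  private
    reflᴾ : ∀ {p} → p ≈ᴾ p
    reflᴾ = coeffwise λ i → refl

    symᴾ : ∀ {p q} → p ≈ᴾ q → q ≈ᴾ p
    symᴾ e = coeffwise λ i → sym (at e i)

    transᴾ : ∀ {p q r} → p ≈ᴾ q → q ≈ᴾ r → p ≈ᴾ r
    transᴾ e f = coeffwise λ i → trans (at e i) (at f i)

    ∷-cong : ∀ {a b p q} → a ≈ b → p ≈ᴾ q → (a ∷ p) ≈ᴾ (b ∷ q)
    ∷-cong e f = coeffwise λ { zero → e ; (suc i) → at f i }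

    0∷[] : (0# ∷ []) ≈ᴾ []
    0∷[] = coeffwise λ { zero → refl ; (suc i) → refl }

    +-congᴾ : ∀ {p p′ q q′} → p ≈ᴾ p′ → q ≈ᴾ q′ → p +ᴾ q ≈ᴾ p′ +ᴾ q′
    +-congᴾ {p} {p′} {q} {q′} e f = coeffwise λ i →
      trans (coeff-+ p q i) (trans (+-cong (at e i) (at f i)) (sym (coeff-+ p′ q′ i)))

    +-assocᴾ : ∀ p q r → (p +ᴾ q) +ᴾ r ≈ᴾ p +ᴾ (q +ᴾ r)
    +-assocᴾ p q r = coeffwise λ i → begin
      coeff ((p +ᴾ q) +ᴾ r) i             ≈⟨ coeff-+ (p +ᴾ q) r i ⟩
      coeff (p +ᴾ q) i + coeff r i        ≈⟨ +-congʳ (coeff-+ p q i) ⟩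
      (coeff p i + coeff q i) + coeff r i ≈⟨ +-assoc _ _ _ ⟩
      coeff p i + (coeff q i + coeff r i) ≈⟨ +-congˡ (coeff-+ q r i) ⟨
      coeff p i + coeff (q +ᴾ r) i        ≈⟨ coeff-+ p (q +ᴾ r) i ⟨
      coeff (p +ᴾ (q +ᴾ r)) i             ∎
      where open R-Reasoning

    +-commᴾ : ∀ p q → p +ᴾ q ≈ᴾ q +ᴾ p
    +-commᴾ p q = coeffwise λ i →
      trans (coeff-+ p q i) (trans (+-comm _ _) (sym (coeff-+ q p i)))

    +-identityʳᴾ : ∀ p → p +ᴾ [] ≈ᴾ p
    +-identityʳᴾ p = coeffwise λ i → trans (coeff-+ p [] i) (+-identityʳ _)

    neg-congᴾ : ∀ {p q} → p ≈ᴾ q → -ᴾ p ≈ᴾ -ᴾ q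
    neg-congᴾ {p} {q} e = coeffwise λ i →
      trans (coeff-neg p i) (trans (-‿cong (at e i)) (sym (coeff-neg q i)))

    inverseʳᴾ : ∀ p → p +ᴾ (-ᴾ p) ≈ᴾ []
    inverseʳᴾ p = coeffwise λ i →
      trans (coeff-+ p _ i) (trans (+-congˡ (coeff-neg p i)) (-‿inverseʳ _))

    inverseˡᴾ : ∀ p → (-ᴾ p) +ᴾ p ≈ᴾ []
    inverseˡᴾ p = transᴾ (+-commᴾ (-ᴾ p) p) (inverseʳᴾ p)

    -- Coefficientwise, products satisfy the recursion on either factor.
    *-congʳᴾ : ∀ p {q r} → q ≈ᴾ r → ∀ i → coeff (p *ᴾ q) i ≈ coeff (p *ᴾ r) i
    *-congʳᴾ []      e i = refl
    *-congʳᴾ (a ∷ p) {q} {r} e zero =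
      trans (coeff-*-zero a p q) (trans (*-congˡ (at e 0)) (sym (coeff-*-zero a p r)))
    *-congʳᴾ (a ∷ p) {q} {r} e (suc i) =
      trans (coeff-*-suc a p q i)
        (trans (+-cong (*-congˡ (at e (suc i))) (*-congʳᴾ p e i)) (sym (coeff-*-suc a p r i)))

    *-zeroʳᴾ : ∀ p i → coeff (p *ᴾ []) i ≈ 0#
    *-zeroʳᴾ []      i       = refl
    *-zeroʳᴾ (a ∷ p) zero    = refl
    *-zeroʳᴾ (a ∷ p) (suc i) = *-zeroʳᴾ p i

    *-∷-zero : ∀ p b q → coeff (p *ᴾ (b ∷ q)) 0 ≈ coeff p 0 * b
    *-∷-zero []      b q = sym (zeroˡ b)
    *-∷-zero (a ∷ p) b q = coeff-*-zero a p (b ∷ q)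

    *-∷-suc : ∀ p b q i →
      coeff (p *ᴾ (b ∷ q)) (suc i) ≈ b * coeff p (suc i) + coeff (p *ᴾ q) i
    *-∷-suc []      b q i = sym (trans (+-identityʳ _) (zeroʳ b))
    *-∷-suc (a ∷ p) b q zero = begin
      coeff ((a ∷ p) *ᴾ (b ∷ q)) 1              ≈⟨ coeff-*-suc a p (b ∷ q) 0 ⟩
      a * coeff q 0 + coeff (p *ᴾ (b ∷ q)) 0    ≈⟨ +-congˡ (*-∷-zero p b q) ⟩
      a * coeff q 0 + coeff p 0 * b             ≈⟨ solve 4 (λ a b x y → a :* x :+ y :* b := b :* y :+ a :* x) refl a b _ _ ⟩
      b * coeff p 0 + a * coeff q 0             ≈⟨ +-congˡ (coeff-*-zero a p q) ⟨
      b * coeff p 0 + coeff ((a ∷ p) *ᴾ q) 0    ∎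
      where open R-Reasoning
    *-∷-suc (a ∷ p) b q (suc i) = begin
      coeff ((a ∷ p) *ᴾ (b ∷ q)) (suc (suc i))
        ≈⟨ coeff-*-suc a p (b ∷ q) (suc i) ⟩
      a * coeff q (suc i) + coeff (p *ᴾ (b ∷ q)) (suc i)
        ≈⟨ +-congˡ (*-∷-suc p b q i) ⟩
      a * coeff q (suc i) + (b * coeff p (suc i) + coeff (p *ᴾ q) i)
        ≈⟨ solve 3 (λ x y z → x :+ (y :+ z) := y :+ (x :+ z)) refl _ _ _ ⟩
      b * coeff p (suc i) + (a * coeff q (suc i) + coeff (p *ᴾ q) i)
        ≈⟨ +-congˡ (coeff-*-suc a p q i) ⟨
      b * coeff p (suc i) + coeff ((a ∷ p) *ᴾ q) (suc i) ∎
      where open R-Reasoning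

    *-comm-at : ∀ p q i → coeff (p *ᴾ q) i ≈ coeff (q *ᴾ p) i
    *-comm-at []      q i = sym (*-zeroʳᴾ q i)
    *-comm-at (a ∷ p) q zero =
      trans (coeff-*-zero a p q) (trans (*-comm _ _) (sym (*-∷-zero q a p)))
    *-comm-at (a ∷ p) q (suc i) =
      trans (coeff-*-suc a p q i)
        (trans (+-congˡ (*-comm-at p q i)) (sym (*-∷-suc q a p i)))

    *-commᴾ : ∀ p q → p *ᴾ q ≈ᴾ q *ᴾ p
    *-commᴾ p q = coeffwise (*-comm-at p q)

    *-congᴾ : ∀ {p p′ q q′} → p ≈ᴾ p′ → q ≈ᴾ q′ → p *ᴾ q ≈ᴾ p′ *ᴾ q′
    *-congᴾ {p} {p′} {q} {q′} e f =
      transᴾ (coeffwise (*-congʳᴾ p f))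
        (transᴾ (*-commᴾ p q′)
          (transᴾ (coeffwise (*-congʳᴾ q′ e)) (*-commᴾ q′ p′)))

    distribʳ-at : ∀ r p q i → coeff ((p +ᴾ q) *ᴾ r) i ≈ coeff (p *ᴾ r) i + coeff (q *ᴾ r) i
    distribʳ-at r []      q       i = sym (+-identityˡ _)
    distribʳ-at r (a ∷ p) []      i = sym (+-identityʳ _)
    distribʳ-at r (a ∷ p) (b ∷ q) zero =
      trans (coeff-*-zero (a + b) (p +ᴾ q) r)
        (trans (distribʳ _ a b)
          (sym (+-cong (coeff-*-zero a p r) (coeff-*-zero b q r))))
    distribʳ-at r (a ∷ p) (b ∷ q) (suc i) = begin
      coeff (((a + b) ∷ (p +ᴾ q)) *ᴾ r) (suc i)
        ≈⟨ coeff-*-suc (a + b) (p +ᴾ q) r i ⟩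
      (a + b) * coeff r (suc i) + coeff ((p +ᴾ q) *ᴾ r) i
        ≈⟨ +-congˡ (distribʳ-at r p q i) ⟩
      (a + b) * coeff r (suc i) + (coeff (p *ᴾ r) i + coeff (q *ᴾ r) i)
        ≈⟨ solve 5 (λ a b x y z → (a :+ b) :* x :+ (y :+ z) := (a :* x :+ y) :+ (b :* x :+ z)) refl a b _ _ _ ⟩
      (a * coeff r (suc i) + coeff (p *ᴾ r) i) + (b * coeff r (suc i) + coeff (q *ᴾ r) i)
        ≈⟨ +-cong (coeff-*-suc a p r i) (coeff-*-suc b q r i) ⟨
      coeff ((a ∷ p) *ᴾ r) (suc i) + coeff ((b ∷ q) *ᴾ r) (suc i) ∎
      where open R-Reasoning

    distribʳᴾ : ∀ r p q → (p +ᴾ q) *ᴾ r ≈ᴾ p *ᴾ r +ᴾ q *ᴾ r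
    distribʳᴾ r p q = coeffwise λ i →
      trans (distribʳ-at r p q i) (sym (coeff-+ (p *ᴾ r) (q *ᴾ r) i))

    distribˡᴾ : ∀ r p q → r *ᴾ (p +ᴾ q) ≈ᴾ r *ᴾ p +ᴾ r *ᴾ q
    distribˡᴾ r p q = transᴾ (*-commᴾ r (p +ᴾ q))
      (transᴾ (distribʳᴾ r p q) (+-congᴾ (*-commᴾ p r) (*-commᴾ q r)))

    ·-assoc-at : ∀ a p q i → coeff ((a · p) *ᴾ q) i ≈ a * coeff (p *ᴾ q) i
    ·-assoc-at a []      q i = sym (zeroʳ a)
    ·-assoc-at a (b ∷ p) q zero =
      trans (coeff-*-zero (a * b) (a · p) q)
        (trans (*-assoc a b _) (*-congˡ (sym (coeff-*-zero b p q))))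
    ·-assoc-at a (b ∷ p) q (suc i) = begin
      coeff ((a * b ∷ a · p) *ᴾ q) (suc i)                  ≈⟨ coeff-*-suc (a * b) (a · p) q i ⟩
      a * b * coeff q (suc i) + coeff ((a · p) *ᴾ q) i      ≈⟨ +-congˡ (·-assoc-at a p q i) ⟩
      a * b * coeff q (suc i) + a * coeff (p *ᴾ q) i        ≈⟨ solve 4 (λ a b x y → a :* b :* x :+ a :* y := a :* (b :* x :+ y)) refl a b _ _ ⟩
      a * (b * coeff q (suc i) + coeff (p *ᴾ q) i)          ≈⟨ *-congˡ (coeff-*-suc b p q i) ⟨
      a * coeff ((b ∷ p) *ᴾ q) (suc i)                      ∎
      where open R-Reasoning

    *-assoc-at : ∀ p q r i → coeff ((p *ᴾ q) *ᴾ r) i ≈ coeff (p *ᴾ (q *ᴾ r)) i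
    *-assoc-at []      q r i = refl
    *-assoc-at (a ∷ p) q r zero = begin
      coeff ((a · q +ᴾ (0# ∷ p *ᴾ q)) *ᴾ r) 0                       ≈⟨ distribʳ-at r (a · q) (0# ∷ p *ᴾ q) 0 ⟩
      coeff ((a · q) *ᴾ r) 0 + coeff ((0# ∷ p *ᴾ q) *ᴾ r) 0         ≈⟨ +-cong (·-assoc-at a q r 0) (coeff-*-zero 0# (p *ᴾ q) r) ⟩
      a * coeff (q *ᴾ r) 0 + 0# * coeff r 0                         ≈⟨ trans (+-congˡ (zeroˡ _)) (+-identityʳ _) ⟩
      a * coeff (q *ᴾ r) 0                                          ≈⟨ coeff-*-zero a p (q *ᴾ r) ⟨
      coeff ((a ∷ p) *ᴾ (q *ᴾ r)) 0                                 ∎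
      where open R-Reasoning
    *-assoc-at (a ∷ p) q r (suc i) = begin
      coeff ((a · q +ᴾ (0# ∷ p *ᴾ q)) *ᴾ r) (suc i)
        ≈⟨ distribʳ-at r (a · q) (0# ∷ p *ᴾ q) (suc i) ⟩
      coeff ((a · q) *ᴾ r) (suc i) + coeff ((0# ∷ p *ᴾ q) *ᴾ r) (suc i)
        ≈⟨ +-cong (·-assoc-at a q r (suc i)) (coeff-*-suc 0# (p *ᴾ q) r i) ⟩
      a * coeff (q *ᴾ r) (suc i) + (0# * coeff r (suc i) + coeff ((p *ᴾ q) *ᴾ r) i)
        ≈⟨ +-congˡ (trans (+-congʳ (zeroˡ _)) (+-identityˡ _)) ⟩
      a * coeff (q *ᴾ r) (suc i) + coeff ((p *ᴾ q) *ᴾ r) i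
        ≈⟨ +-congˡ (*-assoc-at p q r i) ⟩
      a * coeff (q *ᴾ r) (suc i) + coeff (p *ᴾ (q *ᴾ r)) i
        ≈⟨ coeff-*-suc a p (q *ᴾ r) i ⟨
      coeff ((a ∷ p) *ᴾ (q *ᴾ r)) (suc i) ∎
      where open R-Reasoning

    *-identityˡᴾ : ∀ p → const 1# *ᴾ p ≈ᴾ p
    *-identityˡᴾ p = coeffwise λ
      { zero    → trans (coeff-*-zero 1# [] p) (*-identityˡ _)
      ; (suc i) → trans (coeff-*-suc 1# [] p i) (trans (+-identityʳ _) (*-identityˡ _)) }

  polynomialRing : CommutativeRing c ℓ
  polynomialRing = record
    { Carrier = Poly
    ; _≈_     = _≈ᴾ_
    ; _+_     = _+ᴾ_
    ; _*_     = _*ᴾ_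
    ; -_      = -ᴾ_
    ; 0#      = []
    ; 1#      = const 1#
    ; isCommutativeRing = record
      { isRing = record
        { +-isAbelianGroup = record
          { isGroup = record
            { isMonoid = record
              { isSemigroup = record
                { isMagma = record
                  { isEquivalence = record { refl = reflᴾ ; sym = symᴾ ; trans = transᴾ }
                  ; ∙-cong = +-congᴾ }
                ; assoc = +-assocᴾ }
              ; identity = (λ p → reflᴾ) , +-identityʳᴾ }
            ; inverse = inverseˡᴾ , inverseʳᴾ
            ; ⁻¹-cong = neg-congᴾ }
          ; comm = +-commᴾ }
        ; *-cong = *-congᴾ
        ; *-assoc = λ p q r → coeffwise (*-assoc-at p q r)
        ; *-identity = *-identityˡᴾ , λ p → transᴾ (*-commᴾ p (const 1#)) (*-identityˡᴾ p)
        ; distrib = distribˡᴾ , distribʳᴾ }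
      ; *-comm = *-commᴾ } }

  -- "deg p ≤ d", also allowing p = 0.
  Deg≤ : Poly → ℕ → Set ℓ
  Deg≤ p d = ∀ i → d ℕ.< i → coeff p i ≈ 0#

  Deg≤-weaken : ∀ p {d e} → d ℕ.≤ e → Deg≤ p d → Deg≤ p e
  Deg≤-weaken p d≤e P i e<i = P i (ℕ.≤-<-trans d≤e e<i)

  Deg≤-+ : ∀ p q {d} → Deg≤ p d → Deg≤ q d → Deg≤ (p +ᴾ q) d
  Deg≤-+ p q P Q i d<i =
    trans (coeff-+ p q i) (trans (+-cong (P i d<i) (Q i d<i)) (+-identityʳ 0#))

  Deg≤-neg : ∀ p {d} → Deg≤ p d → Deg≤ (-ᴾ p) d
  Deg≤-neg p P i d<i = trans (coeff-neg p i) (trans (-‿cong (P i d<i)) -0#≈0#)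

  Deg≤-const : ∀ a d → Deg≤ (const a) d
  Deg≤-const a d (suc i) _ = refl

  private
    []-* : ∀ p q → (∀ i → coeff p i ≈ 0#) → ∀ i → coeff (p *ᴾ q) i ≈ 0#
    []-* p q z i = at (*-congᴾ {p} {[]} {q} {q} (coeffwise z) reflᴾ) i

  Deg≤-* : ∀ p q {d e} → Deg≤ p d → Deg≤ q e → Deg≤ (p *ᴾ q) (d ℕ.+ e)
  Deg≤-* []      q P Q i _ = refl
  Deg≤-* (a ∷ p) q {d} {e} P Q (suc i) lt = begin
    coeff ((a ∷ p) *ᴾ q) (suc i)               ≈⟨ coeff-*-suc a p q i ⟩
    a * coeff q (suc i) + coeff (p *ᴾ q) i     ≈⟨ +-cong (*-congˡ (Q (suc i) (ℕ.≤-<-trans (ℕ.m≤n+m e d) lt))) (tail-vanishes d P lt) ⟩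
    a * 0# + 0#                                ≈⟨ trans (+-identityʳ _) (zeroʳ a) ⟩
    0#                                         ∎
    where
    open R-Reasoning
    tail-vanishes : ∀ d → Deg≤ (a ∷ p) d → d ℕ.+ e ℕ.< suc i → coeff (p *ᴾ q) i ≈ 0#
    tail-vanishes zero    P _  = []-* p q (λ j → P (suc j) (ℕ.s≤s ℕ.z≤n)) i
    tail-vanishes (suc d) P lt =
      Deg≤-* p q (λ j d<j → P (suc j) (ℕ.s≤s d<j)) Q i (ℕ.s<s⁻¹ lt)

  coeff-*-top : ∀ p q {d e} → Deg≤ p d → Deg≤ q e →
                coeff (p *ᴾ q) (d ℕ.+ e) ≈ coeff p d * coeff q e
  coeff-*-top []      q P Q = sym (zeroˡ _)
  coeff-*-top (a ∷ p) q {zero} {zero} P Q = coeff-*-zero a p q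
  coeff-*-top (a ∷ p) q {zero} {suc e} P Q =
    trans (coeff-*-suc a p q e)
      (trans (+-congˡ ([]-* p q (λ j → P (suc j) (ℕ.s≤s ℕ.z≤n)) e)) (+-identityʳ _))
  coeff-*-top (a ∷ p) q {suc d} {e} P Q = begin
    coeff ((a ∷ p) *ᴾ q) (suc (d ℕ.+ e))                        ≈⟨ coeff-*-suc a p q (d ℕ.+ e) ⟩
    a * coeff q (suc (d ℕ.+ e)) + coeff (p *ᴾ q) (d ℕ.+ e)      ≈⟨ +-cong (*-congˡ (Q _ (ℕ.s≤s (ℕ.m≤n+m e d)))) (coeff-*-top p q (λ j d<j → P (suc j) (ℕ.s≤s d<j)) Q) ⟩
    a * 0# + coeff p d * coeff q e                              ≈⟨ trans (+-congʳ (zeroʳ a)) (+-identityˡ _) ⟩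
    coeff p d * coeff q e                                       ∎
    where open R-Reasoning

record IsDomain (R : CommutativeRing c ℓ) : Set (c ⊔ ℓ) where
  open CommutativeRing R hiding (zero)
  field
    1≉0       : ¬ 1# ≈ 0#
    zero?     : ∀ a → Dec (a ≈ 0#)
    *-nonzero : ∀ {a b} → ¬ a ≈ 0# → ¬ b ≈ 0# → ¬ a * b ≈ 0#

  *-cancelˡ-nonzero : ∀ {a b c} → ¬ c ≈ 0# → c * a ≈ c * b → a ≈ b
  *-cancelˡ-nonzero {a} {b} {c} c≉0 eq with zero? (a - b)
  ... | yes a-b≈0 = x-y≈0⇒x≈y a-b≈0
    where
    open Relation.Binary.Reasoning.Setoid setoid
    x-y≈0⇒x≈y : a - b ≈ 0# → a ≈ b
    x-y≈0⇒x≈y e = begin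
      a             ≈⟨ +-identityʳ a ⟨
      a + 0#        ≈⟨ +-congˡ (-‿inverseˡ b) ⟨
      a + (- b + b) ≈⟨ +-assoc a (- b) b ⟨
      a - b + b     ≈⟨ +-congʳ e ⟩
      0# + b        ≈⟨ +-identityˡ b ⟩
      b             ∎
  ... | no  a-b≉0 = ⊥-elim (*-nonzero c≉0 a-b≉0 (begin
      c * (a - b)       ≈⟨ distribˡ c a (- b) ⟩
      c * a + c * - b   ≈⟨ +-cong eq (sym (-‿distribʳ-* c b)) ⟩
      c * b - c * b     ≈⟨ -‿inverseʳ _ ⟩
      0#                ∎))
    where
    open Relation.Binary.Reasoning.Setoid setoid
    open Algebra.Properties.Ring ring using (-‿distribʳ-*)

module PolynomialDomain (R : CommutativeRing c ℓ) (dom : IsDomain R) where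
  open CommutativeRing R hiding (zero)
  open Polynomial R
  open IsDomain dom

  zero?ᴾ : ∀ p → Dec (p ≈ᴾ [])
  zero?ᴾ [] = yes (coeffwise λ i → refl)
  zero?ᴾ (a ∷ p) with zero? a | zero?ᴾ p
  ... | yes a≈0 | yes p≈0 = yes (coeffwise λ { zero → a≈0 ; (suc i) → at p≈0 i })
  ... | no  a≉0 | _       = no λ e → a≉0 (at e 0)
  ... | yes _   | no  p≉0 = no λ e → p≉0 (coeffwise λ i → at e (suc i))

  nonzero-coeff : ∀ {p} i → ¬ coeff p i ≈ 0# → ¬ p ≈ᴾ []
  nonzero-coeff i ne e = ne (at e i)

  leading : ∀ p → ¬ p ≈ᴾ [] → Σ[ d ∈ ℕ ] Deg≤ p d × ¬ coeff p d ≈ 0#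
  leading []      p≉0 = ⊥-elim (p≉0 (coeffwise λ i → refl))
  leading (a ∷ p) a∷p≉0 with zero?ᴾ p
  ... | yes p≈0 = 0 , (λ { (suc i) _ → at p≈0 i }) ,
                  λ a≈0 → a∷p≉0 (coeffwise λ { zero → a≈0 ; (suc i) → at p≈0 i })
  ... | no  p≉0 with leading p p≉0
  ...   | d , P , ne = suc d , (λ { (suc i) lt → P i (ℕ.s<s⁻¹ lt) }) , ne

  *-nonzero-top : ∀ p q {d e} → Deg≤ p d → Deg≤ q e →
    ¬ coeff p d ≈ 0# → ¬ coeff q e ≈ 0# → ¬ coeff (p *ᴾ q) (d ℕ.+ e) ≈ 0#
  *-nonzero-top p q P Q np nq eq =
    *-nonzero np nq (trans (sym (coeff-*-top p q P Q)) eq)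

  isDomain : IsDomain polynomialRing
  isDomain = record
    { 1≉0 = λ e → 1≉0 (at e 0)
    ; zero? = zero?ᴾ
    ; *-nonzero = λ {p} {q} p≉0 q≉0 →
        let d , P , np = leading p p≉0
            e , Q , nq = leading q q≉0
        in nonzero-coeff (d ℕ.+ e) (*-nonzero-top p q P Q np nq)
    }

module FractionField (D : CommutativeRing c ℓ) (dom : IsDomain D) where
  open CommutativeRing D hiding (zero)
  open IsDomain dom
  open Algebra.Properties.Ring ring using (-‿distribˡ-*)

  infix 8 _/_[_]
  record Fraction : Set (c ⊔ ℓ) where
    constructor _/_[_]
    field
      num   : Carrier
      den   : Carrier
      den≉0 : ¬ den ≈ 0#
  open Fraction public

  infix 4 _≈ꟳ_
  record _≈ꟳ_ (f g : Fraction) : Set ℓ where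
    constructor cross
    field crossed : num f * den g ≈ num g * den f
  open _≈ꟳ_ public

  ι : Carrier → Fraction
  ι a = a / 1# [ 1≉0 ]

  infixl 6 _+ꟳ_
  infixl 7 _*ꟳ_

  _+ꟳ_ : Fraction → Fraction → Fraction
  f +ꟳ g = (num f * den g + num g * den f) / (den f * den g)
             [ *-nonzero (den≉0 f) (den≉0 g) ]

  _*ꟳ_ : Fraction → Fraction → Fraction
  f *ꟳ g = (num f * num g) / (den f * den g) [ *-nonzero (den≉0 f) (den≉0 g) ]

  -ꟳ_ : Fraction → Fraction
  -ꟳ f = (- num f) / den f [ den≉0 f ]

  private
    open Relation.Binary.Reasoning.Setoid setoid
    open Algebra.Solver.Ring.NaturalCoefficients.Default commutativeSemiring
      using (solve; _:+_; _:*_; _:=_)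

    transꟳ : ∀ {f g h} → f ≈ꟳ g → g ≈ꟳ h → f ≈ꟳ h
    transꟳ {a / b [ _ ]} {p / q [ q≉0 ]} {s / t [ _ ]} (cross e₁) (cross e₂) =
      cross (*-cancelˡ-nonzero q≉0 (begin
        q * (a * t)   ≈⟨ solve 3 (λ q a t → q :* (a :* t) := (a :* q) :* t) refl q a t ⟩
        (a * q) * t   ≈⟨ *-congʳ e₁ ⟩
        (p * b) * t   ≈⟨ solve 3 (λ p b t → (p :* b) :* t := (p :* t) :* b) refl p b t ⟩
        (p * t) * b   ≈⟨ *-congʳ e₂ ⟩
        (s * q) * b   ≈⟨ solve 3 (λ s q b → (s :* q) :* b := q :* (s :* b)) refl s q b ⟩
        q * (s * b)   ∎))

    +-congꟳ : ∀ {f f′ g g′} → f ≈ꟳ f′ → g ≈ꟳ g′ → f +ꟳ g ≈ꟳ f′ +ꟳ g′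
    +-congꟳ {a / b [ _ ]} {a′ / b′ [ _ ]} {p / q [ _ ]} {p′ / q′ [ _ ]} (cross e₁) (cross e₂) =
      cross (begin
        (a * q + p * b) * (b′ * q′)
          ≈⟨ solve 6 (λ a b p q b′ q′ → (a :* q :+ p :* b) :* (b′ :* q′)
               := (a :* b′) :* (q :* q′) :+ (p :* q′) :* (b :* b′)) refl a b p q b′ q′ ⟩
        (a * b′) * (q * q′) + (p * q′) * (b * b′)
          ≈⟨ +-cong (*-congʳ e₁) (*-congʳ e₂) ⟩
        (a′ * b) * (q * q′) + (p′ * q) * (b * b′)
          ≈⟨ solve 6 (λ a′ b p′ q b′ q′ → (a′ :* b) :* (q :* q′) :+ (p′ :* q) :* (b :* b′)
               := (a′ :* q′ :+ p′ :* b′) :* (b :* q)) refl a′ b p′ q b′ q′ ⟩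
        (a′ * q′ + p′ * b′) * (b * q) ∎)

    *-congꟳ : ∀ {f f′ g g′} → f ≈ꟳ f′ → g ≈ꟳ g′ → f *ꟳ g ≈ꟳ f′ *ꟳ g′
    *-congꟳ {a / b [ _ ]} {a′ / b′ [ _ ]} {p / q [ _ ]} {p′ / q′ [ _ ]} (cross e₁) (cross e₂) =
      cross (begin
        (a * p) * (b′ * q′)  ≈⟨ solve 4 (λ a p b q → (a :* p) :* (b :* q) := (a :* b) :* (p :* q)) refl a p b′ q′ ⟩
        (a * b′) * (p * q′)  ≈⟨ *-cong e₁ e₂ ⟩
        (a′ * b) * (p′ * q)  ≈⟨ solve 4 (λ a b p q → (a :* b) :* (p :* q) := (a :* p) :* (b :* q)) refl a′ b p′ q ⟩
        (a′ * p′) * (b * q)  ∎)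

    -‿congꟳ : ∀ {f f′} → f ≈ꟳ f′ → -ꟳ f ≈ꟳ -ꟳ f′
    -‿congꟳ {a / b [ _ ]} {a′ / b′ [ _ ]} (cross e) = cross (begin
      - a * b′    ≈⟨ -‿distribˡ-* a b′ ⟨
      - (a * b′)  ≈⟨ -‿cong e ⟩
      - (a′ * b)  ≈⟨ -‿distribˡ-* a′ b ⟩
      - a′ * b    ∎)

    +-assocꟳ : ∀ f g h → (f +ꟳ g) +ꟳ h ≈ꟳ f +ꟳ (g +ꟳ h)
    +-assocꟳ (a / b [ _ ]) (p / q [ _ ]) (s / t [ _ ]) = cross
      (solve 6 (λ a b p q s t →
        ((a :* q :+ p :* b) :* t :+ s :* (b :* q)) :* (b :* (q :* t))
        := (a :* (q :* t) :+ (p :* t :+ s :* q) :* b) :* ((b :* q) :* t)) refl a b p q s t)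

    +-commꟳ : ∀ f g → f +ꟳ g ≈ꟳ g +ꟳ f
    +-commꟳ (a / b [ _ ]) (p / q [ _ ]) = cross
      (solve 4 (λ a b p q → (a :* q :+ p :* b) :* (q :* b) := (p :* b :+ a :* q) :* (b :* q))
        refl a b p q)

    +-identityˡꟳ : ∀ f → ι 0# +ꟳ f ≈ꟳ f
    +-identityˡꟳ (a / b [ _ ]) = cross (begin
      (0# * b + a * 1#) * b   ≈⟨ *-congʳ (trans (+-congʳ (zeroˡ b)) (+-identityˡ _)) ⟩
      (a * 1#) * b            ≈⟨ *-assoc a 1# b ⟩
      a * (1# * b)            ∎)

    inverseˡꟳ : ∀ f → (-ꟳ f) +ꟳ f ≈ꟳ ι 0#
    inverseˡꟳ (a / b [ _ ]) = cross (begin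
      (- a * b + a * b) * 1#   ≈⟨ *-identityʳ _ ⟩
      - a * b + a * b          ≈⟨ distribʳ b (- a) a ⟨
      (- a + a) * b            ≈⟨ *-congʳ (-‿inverseˡ a) ⟩
      0# * b                   ≈⟨ zeroˡ b ⟩
      0#                       ≈⟨ zeroˡ _ ⟨
      0# * (b * b)             ∎)

    *-assocꟳ : ∀ f g h → (f *ꟳ g) *ꟳ h ≈ꟳ f *ꟳ (g *ꟳ h)
    *-assocꟳ (a / b [ _ ]) (p / q [ _ ]) (s / t [ _ ]) = cross
      (solve 6 (λ a b p q s t → ((a :* p) :* s) :* (b :* (q :* t))
        := (a :* (p :* s)) :* ((b :* q) :* t)) refl a b p q s t)

    *-commꟳ : ∀ f g → f *ꟳ g ≈ꟳ g *ꟳ f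
    *-commꟳ (a / b [ _ ]) (p / q [ _ ]) = cross (*-cong (*-comm a p) (*-comm q b))

    *-identityˡꟳ : ∀ f → ι 1# *ꟳ f ≈ꟳ f
    *-identityˡꟳ (a / b [ _ ]) = cross
      (trans (*-congʳ (*-identityˡ a)) (*-congˡ (sym (*-identityˡ b))))

    distribʳꟳ : ∀ f g h → (g +ꟳ h) *ꟳ f ≈ꟳ g *ꟳ f +ꟳ h *ꟳ f
    distribʳꟳ (a / b [ _ ]) (p / q [ _ ]) (s / t [ _ ]) = cross
      (solve 6 (λ a b p q s t → ((p :* t :+ s :* q) :* a) :* ((q :* b) :* (t :* b))
        := ((p :* a) :* (t :* b) :+ (s :* a) :* (q :* b)) :* ((q :* t) :* b)) refl a b p q s t)

  -- If x q = e + p then y = q / e satisfies x y = 1 + (p / q) y.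
  invert-x-minus : ∀ {x p q e} (q≉0 : ¬ q ≈ 0#) (e≉0 : ¬ e ≈ 0#) → x * q ≈ e + p →
    ι x *ꟳ q / e [ e≉0 ] ≈ꟳ ι 1# +ꟳ p / q [ q≉0 ] *ꟳ q / e [ e≉0 ]
  invert-x-minus {x} {p} {q} {e} q≉0 e≉0 eq = cross (begin
    (x * q) * (1# * (q * e))                  ≈⟨ *-cong eq (*-identityˡ (q * e)) ⟩
    (e + p) * (q * e)                         ≈⟨ solve 3 (λ e p q → (e :+ p) :* (q :* e) := (q :* e :+ p :* q) :* e) refl e p q ⟩
    (q * e + p * q) * e                       ≈⟨ *-cong (+-cong (*-identityˡ _) (*-identityʳ _)) (*-identityˡ e) ⟨
    (1# * (q * e) + (p * q) * 1#) * (1# * e)  ∎)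

  fractionField : CommutativeRing (c ⊔ ℓ) ℓ
  fractionField = record
    { Carrier = Fraction
    ; _≈_     = _≈ꟳ_
    ; _+_     = _+ꟳ_
    ; _*_     = _*ꟳ_
    ; -_      = -ꟳ_
    ; 0#      = ι 0#
    ; 1#      = ι 1#
    ; isCommutativeRing = record
      { isRing = record
        { +-isAbelianGroup = record
          { isGroup = record
            { isMonoid = record
              { isSemigroup = record
                { isMagma = record
                  { isEquivalence = record
                    { refl = cross refl ; sym = λ e → cross (sym (crossed e)) ; trans = transꟳ }
                  ; ∙-cong = +-congꟳ }
                ; assoc = +-assocꟳ }
              ; identity = +-identityˡꟳ , λ f → transꟳ (+-commꟳ f (ι 0#)) (+-identityˡꟳ f) }
            ; inverse = inverseˡꟳ , λ f → transꟳ (+-commꟳ f (-ꟳ f)) (inverseˡꟳ f)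
            ; ⁻¹-cong = -‿congꟳ }
          ; comm = +-commꟳ }
        ; *-cong = *-congꟳ
        ; *-assoc = *-assocꟳ
        ; *-identity = *-identityˡꟳ , λ f → transꟳ (*-commꟳ f (ι 1#)) (*-identityˡꟳ f)
        ; distrib = (λ f g h → transꟳ (*-commꟳ f (g +ꟳ h))
                       (transꟳ (distribʳꟳ f g h) (+-congꟳ (*-commꟳ g f) (*-commꟳ h f))))
                  , distribʳꟳ }
      ; *-comm = *-commꟳ } }

ℚ-isDomain : IsDomain ℚ.+-*-commutativeRing
ℚ-isDomain = record
  { 1≉0       = λ ()
  ; zero?     = ℚ._≟ 0ℚ
  ; *-nonzero = λ {a} {b} a≢0 b≢0 ab≡0 → b≢0 (cancel a b a≢0 ab≡0)
  }
  where
  cancel : ∀ a b → ¬ a ≡ 0ℚ → a ℚ.* b ≡ 0ℚ → b ≡ 0ℚ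
  cancel a b a≢0 ab≡0 = begin
    b                          ≡⟨ ℚ.*-identityˡ b ⟨
    1ℚ ℚ.* b                   ≡⟨ ≡.cong (ℚ._* b) (ℚ.*-inverseˡ a) ⟨
    ((ℚ.1/ a) ℚ.* a) ℚ.* b     ≡⟨ ℚ.*-assoc (ℚ.1/ a) a b ⟩
    (ℚ.1/ a) ℚ.* (a ℚ.* b)     ≡⟨ ≡.cong ((ℚ.1/ a) ℚ.*_) ab≡0 ⟩
    (ℚ.1/ a) ℚ.* 0ℚ            ≡⟨ ℚ.*-zeroʳ (ℚ.1/ a) ⟩
    0ℚ                         ∎
    where
    open ≡.≡-Reasoning
    instance
      a≢0′ : ℚ.NonZero a
      a≢0′ = ℚ.≢-nonZero a≢0

open Polynomial ℚ.+-*-commutativeRing public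
  using (const; X) renaming (polynomialRing to ℚ[x])

ℚ[x]-isDomain : IsDomain ℚ[x]
ℚ[x]-isDomain = PolynomialDomain.isDomain ℚ.+-*-commutativeRing ℚ-isDomain

open FractionField ℚ[x] ℚ[x]-isDomain public
  using (ι) renaming (fractionField to ℚ⟨x⟩)

module Matrix-ℚ    = MatrixOver ℚ.+-*-commutativeRing
module Matrix-ℚ[x] = MatrixOver ℚ[x]
module Matrix-ℚ⟨x⟩ = MatrixOver ℚ⟨x⟩

-- Fractions num / den with deg num ≤ deg den.
private
  module Proper where
    open Polynomial ℚ.+-*-commutativeRing hiding (const; X)
    open PolynomialDomain ℚ.+-*-commutativeRing ℚ-isDomain
    open FractionField ℚ[x] ℚ[x]-isDomain hiding (ι)
    open CommutativeRing ℚ[x] hiding (zero)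

    IsProper : Fraction → Set
    IsProper f = Σ[ d ∈ ℕ ] Deg≤ (num f) d × Deg≤ (den f) d × ¬ coeff (den f) d ≡ 0ℚ

    proper-const : ∀ a → IsProper (ι (const a))
    proper-const a = 0 , Deg≤-const a 0 , Deg≤-const 1ℚ 0 , λ ()

    proper-* : ∀ {f g} → IsProper f → IsProper g → IsProper (f *ꟳ g)
    proper-* {f} {g} (d , Nf , Df , nf) (e , Ng , Dg , ng) =
      d ℕ.+ e , Deg≤-* (num f) (num g) Nf Ng , Deg≤-* (den f) (den g) Df Dg
      , *-nonzero-top (den f) (den g) Df Dg nf ng

    proper-+ : ∀ {f g} → IsProper f → IsProper g → IsProper (f +ꟳ g)
    proper-+ {f} {g} (d , Nf , Df , nf) (e , Ng , Dg , ng) =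
      d ℕ.+ e
      , Deg≤-+ (num f *ᴾ den g) (num g *ᴾ den f) (Deg≤-* (num f) (den g) Nf Dg)
          (≡.subst (Deg≤ (num g *ᴾ den f)) (ℕ.+-comm e d) (Deg≤-* (num g) (den f) Ng Df))
      , Deg≤-* (den f) (den g) Df Dg
      , *-nonzero-top (den f) (den g) Df Dg nf ng

    pivot : ∀ f → IsProper f →
      Σ[ y ∈ Fraction ] IsProper y × (ι X *ꟳ y) ≈ꟳ (ι 1# +ꟳ f *ꟳ y)
    pivot f@(p / q [ q≉0 ]) (d , N , D , ne) =
      (q / e [ nonzero-coeff (suc d) top ]) ,
      (suc d , Deg≤-weaken q (ℕ.n≤1+n d) D , E , top) ,
      invert-x-minus {X} {p} {q} {e} q≉0 (nonzero-coeff (suc d) top) Xq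
      where
      open Relation.Binary.Reasoning.Setoid setoid
      e : Poly
      e = X * q - p
      Xq : X * q ≈ e + p
      Xq = sym (begin
        (X * q - p) + p     ≈⟨ +-assoc (X * q) (- p) p ⟩
        X * q + (- p + p)   ≈⟨ +-congˡ {X * q} (-‿inverseˡ p) ⟩
        X * q + 0#          ≈⟨ +-identityʳ (X * q) ⟩
        X * q               ∎)
      X≤1 : Deg≤ X 1
      X≤1 (suc zero) (ℕ.s≤s ())
      X≤1 (suc (suc i)) _ = ≡.refl
      E : Deg≤ e (suc d)
      E = Deg≤-+ (X * q) (- p) (Deg≤-* X q X≤1 D)
            (Deg≤-neg p (Deg≤-weaken p (ℕ.n≤1+n d) N))
      coeff-e : coeff e (suc d) ≡ coeff q d
      coeff-e = ≡.trans (coeff-+ (X * q) (- p) (suc d))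
        (≡.trans (≡.cong₂ ℚ._+_ (coeff-*-top X q X≤1 D) (Deg≤-neg p N (suc d) ℕ.≤-refl))
          (≡.trans (ℚ.+-identityʳ _) (ℚ.*-identityˡ _)))
      top : ¬ coeff e (suc d) ≡ 0ℚ
      top e≡0 = ne (≡.trans (≡.sym coeff-e) e≡0)

A : Graph n → Matrix-ℚ.Matrix n
A G i j = if adj G i j then 1ℚ else 0ℚ

f : Matrix-ℚ.Matrix n → CommutativeRing.Carrier ℚ[x]
f N = det (X I- λ i j → const (N i j))
  where open Matrix-ℚ[x]

x : CommutativeRing.Carrier ℚ⟨x⟩
x = ι X

toℚ⟨x⟩ : Matrix-ℚ.Matrix n → Matrix-ℚ⟨x⟩.Matrix n
toℚ⟨x⟩ N i j = ι (const (N i j))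

xI-_⁻¹ : (N : Matrix-ℚ.Matrix n) → Matrix-ℚ⟨x⟩.Inverse (x Matrix-ℚ⟨x⟩.I- toℚ⟨x⟩ N)
xI- N ⁻¹ = resolvent (toℚ⟨x⟩ N) (λ i j → proper-const (N i j))
  where
  open Proper
  open Matrix-ℚ⟨x⟩.Resolvent x IsProper (λ {a} {b} → proper-+ {a} {b})
    (λ {a} {b} → proper-* {a} {b}) pivot

Γ : Matrix-ℚ.Matrix n → CommutativeRing.Carrier ℚ⟨x⟩
Γ {n} N = sum {n} (λ i → sum {n} (λ j → 1# * matrix i j * 1#))
  where
  open CommutativeRing ℚ⟨x⟩ using (_*_; 1#)
  open Matrix-ℚ⟨x⟩ using (sum; module Inverse)
  open Inverse (xI- N ⁻¹) using (matrix)

-- The determinant is multiplicative, being up to a scalar the only alternating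
-- multilinear function of the rows. Order the vertices of G with those of F
-- first: x I - A(G) = (P B; C I_k ⊗ D) with D = x I - A(H₁), and since v is joined
-- to all of H₁ the entry of B at (a , (i , w)) is -1 if a = v i and 0 otherwise.
-- With r = 1ᵀ D⁻¹ and Y a (i , w) = [a = v i] r w one has B + Y (I_k ⊗ D) = 0, so
-- the determinant is det D ^ k * det (P + Y C), and Y C is -(1ᵀ D⁻¹ 1) on the
-- diagonal at v 1, ..., v k and 0 elsewhere.
module Submission where

open import Defs
open import Algebra.Bundles using (CommutativeRing)
open import Algebra.Morphism.Structures using (IsRingHomomorphism)
import Algebra.Properties.Ring
import Algebra.Properties.Semiring.Exp
import Algebra.Solver.Ring.NaturalCoefficients.Default
open import Data.Bool.Base using (Bool; true; false; _∧_; if_then_else_)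
open import Data.Fin.Base as Fin using (Fin; zero; suc; toℕ; punchIn; splitAt; combine; remQuot; quotient; remainder; _↑ˡ_; _↑ʳ_)
open import Data.Fin.Permutation as Perm using (Permutation′; _⟨$⟩ʳ_; _⟨$⟩ˡ_)
open import Data.Fin.Properties as Fin
  using (suc-injective; punchInᵢ≢i; splitAt-↑ˡ; splitAt-↑ʳ; ↑ˡ-injective; ↑ʳ-injective; toℕ-↑ˡ;
         combine-injective; combine-surjective; remQuot-combine)
open import Data.Fin.Subset using (∣_∣) renaming (⊤ to ⊤ˢ)
open import Data.Fin.Subset.Properties using (∣p∣≡n⇒p≡⊤)
open import Data.Nat.Base as ℕ using (ℕ; zero; suc; _≤_)
import Data.Nat.Properties as ℕ
open import Data.Product.Base using (_×_; _,_)
open import Data.Rational.Base using (0ℚ; 1ℚ)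
import Data.Rational.Properties as ℚ
open import Data.Sum.Base using (_⊎_; inj₁; inj₂; map₂)
open import Data.Unit.Polymorphic.Base using (⊤; tt)
open import Data.Vec.Base using (lookup; tabulate)
open import Data.Vec.Functional using (_∷_)
open import Data.Vec.Properties using (lookup∘tabulate; lookup-replicate)
open import Function.Base using (_∘_)
open import Function.Bundles using (Injection; mk⇔)
open import Function.Definitions using (Injective)
open import Function.Properties.Inverse using (↔⇒↣)
open import Level using (Level; _⊔_)
open import Relation.Binary.PropositionalEquality as ≡ using (_≡_; _≢_; _≗_)
import Relation.Binary.Reasoning.Setoid
open import Relation.Nullary using (Dec; yes; no; does; contradiction)
open import Relation.Nullary.Decidable using (dec-true; dec-false; does-⇔; _×-dec_)

-- `det` is given by expansion along the first row, and this shapes the determinant theory. Such an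
-- expansion meets two equal rows either as the first two rows or inside every minor; a first row
-- equal to a distant one is in neither position. Hence vanishing is proved for adjacent equal rows,
-- and rows farther apart are reached by swapping neighbours. The zero blocks are likewise placed
-- where a row or column expansion can use them. `Y` is - B (I_k ⊗ D⁻¹), the solution of the
-- elimination equation. Row a of B is - [a = v i] 1ᵀ on pocket i, so D⁻¹ enters only through its
-- column sums r = 1ᵀ D⁻¹. The rows of C have the same shape, so r is in turn seen only through r 1
-- = 1ᵀ D⁻¹ 1. This is how the degree hypothesis reduces a whole inverse matrix to the coronal. D
-- has an inverse over the rational functions, though in general none over the polynomials. The
-- computation therefore runs over `ℚ⟨x⟩`, and `ι` carries the characteristic polynomials there.

private
  variable
    c ℓ : Level
    m n : ℕ

-- Indices of matrices split into two blocks.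

↑-elim : ∀ m {p} (P : Fin (m ℕ.+ n) → Set p) → (∀ i → P (i ↑ˡ n)) → (∀ j → P (m ↑ʳ j)) → ∀ i → P i
↑-elim zero    P left right i       = right i
↑-elim (suc m) P left right zero    = left zero
↑-elim (suc m) P left right (suc i) = ↑-elim m (P ∘ suc) (left ∘ suc) right i

punchIn-↑ˡ : ∀ (j : Fin (suc m)) (l : Fin m) → punchIn (j ↑ˡ n) (l ↑ˡ n) ≡ punchIn j l ↑ˡ n
punchIn-↑ˡ zero    l       = ≡.refl
punchIn-↑ˡ (suc j) zero    = ≡.refl
punchIn-↑ˡ (suc j) (suc l) = ≡.cong suc (punchIn-↑ˡ j l)

punchIn-↑ʳ : ∀ (j : Fin (suc m)) (l : Fin n) → punchIn (j ↑ˡ n) (m ↑ʳ l) ≡ suc (m ↑ʳ l)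
punchIn-↑ʳ             zero    l = ≡.refl
punchIn-↑ʳ {m = suc m} (suc j) l = ≡.cong suc (punchIn-↑ʳ j l)

-- Alternating multilinear functions of the rows.

module Determinant (K : CommutativeRing c ℓ) where
  open CommutativeRing K hiding (zero)
  open MatrixOver K
  open Algebra.Properties.Ring ring
  open Relation.Binary.Reasoning.Setoid setoid
  open Algebra.Solver.Ring.NaturalCoefficients.Default commutativeSemiring
    using (solve; _:+_; _:*_; _:=_)

  infix 4 _≋_
  _≋_ : (Fin n → Carrier) → (Fin n → Carrier) → Set ℓ
  t ≋ t′ = ∀ i → t i ≈ t′ i

  sum-zero : (t : Fin n → Carrier) → (∀ i → t i ≈ 0#) → sum t ≈ 0#
  sum-zero {n} t t≈0 = trans (sum-cong-≋ t≈0) (sum-replicate-zero n)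

  sum-cong : (t t′ : Fin n → Carrier) → t ≋ t′ → sum t ≈ sum t′
  sum-cong t t′ e = sum-cong-≋ e

  -- The number `m` of rows and their length `n` are independent, because fixing the first row
  -- lowers only `m`. Linearity relates three families that agree off row `i` instead of replacing a
  -- row: functions are compared only pointwise and up to `_≈_`.
  record Alternating (f : (Fin m → Fin n → Carrier) → Carrier) : Set (c ⊔ ℓ) where
    field
      cong   : ∀ {u v} → (∀ i → u i ≋ v i) → f u ≈ f v
      linear : ∀ i s {u v w} → (∀ j → j ≢ i → w j ≋ u j) → (∀ j → j ≢ i → w j ≋ v j) →
               (∀ l → w i l ≈ u i l + s * v i l) → f w ≈ f u + s * f v
      adjacent : ∀ {i j v} → toℕ j ≡ suc (toℕ i) → v i ≋ v j → f v ≈ 0#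

  open Alternating

  private
    linear₀ : ∀ {f : (Fin (suc m) → Fin n → Carrier) → Carrier} → Alternating f →
              ∀ s {u u₁ u₂ : Fin n → Carrier} {v} → (∀ l → u l ≈ u₁ l + s * u₂ l) →
              f (u ∷ v) ≈ f (u₁ ∷ v) + s * f (u₂ ∷ v)
    linear₀ alt s = linear alt zero s rest rest
      where
      rest : ∀ {u u′ : Fin n → Carrier} {v} j → j ≢ zero → (u ∷ v) j ≋ (u′ ∷ v) j
      rest zero    0≢0 = contradiction ≡.refl 0≢0
      rest (suc j) _   = λ l → refl

  uncons : ∀ {f : (Fin (suc m) → Fin n → Carrier) → Carrier} → Alternating f →
           ∀ v → f v ≈ f (v zero ∷ v ∘ suc)
  uncons alt v = cong alt λ { zero l → refl ; (suc i) l → refl }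

  alternating-∷ : ∀ {f : (Fin (suc m) → Fin n → Carrier) → Carrier} → Alternating f →
                  ∀ t → Alternating (λ v → f (t ∷ v))
  alternating-∷ {m = m} {n = n} alt t = record
    { cong     = λ e → cong alt λ { zero l → refl ; (suc i) l → e i l }
    ; linear   = λ i s eu ev ew → linear alt (suc i) s (lift eu) (lift ev) ew
    ; adjacent = λ {i} {j} eq e → adjacent alt {suc i} {suc j} (≡.cong suc eq) e
    }
    where
    lift : ∀ {i : Fin m} {u v : Fin m → Fin n → Carrier} → (∀ j → j ≢ i → u j ≋ v j) →
           ∀ j → j ≢ suc i → (t ∷ u) j ≋ (t ∷ v) j
    lift e zero    _   = λ l → refl
    lift e (suc j) j≢i = e j (j≢i ∘ ≡.cong suc)

  -- Adding the first row to the second changes nothing, so both terms may be given the second row a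
  -- + b. Their sum is then the value at two equal rows a + b.
  swap : ∀ {f : (Fin (suc (suc m)) → Fin n → Carrier) → Carrier} → Alternating f →
         ∀ a b v → f (a ∷ b ∷ v) ≈ - f (b ∷ a ∷ v)
  swap {f = f} alt a b v = +-inverseˡ-unique _ _ (begin
    f (a ∷ b ∷ v) + f (b ∷ a ∷ v)
      ≈⟨ +-cong (second a) (second b) ⟨
    f (a ∷ a+b ∷ v) + f (b ∷ b+a ∷ v)
      ≈⟨ +-congˡ (cong alt λ { zero l → refl ; (suc zero) l → +-comm (b l) (a l) ; (suc (suc i)) l → refl }) ⟩
    f (a ∷ a+b ∷ v) + f (b ∷ a+b ∷ v)
      ≈⟨ +-congˡ (*-identityˡ _) ⟨
    f (a ∷ a+b ∷ v) + 1# * f (b ∷ a+b ∷ v)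
      ≈⟨ linear₀ alt 1# (λ l → +-congˡ (sym (*-identityˡ (b l)))) ⟨
    f (a+b ∷ a+b ∷ v)
      ≈⟨ adjacent alt {zero} {suc zero} ≡.refl (λ l → refl) ⟩
    0# ∎)
    where
    a+b b+a : Fin _ → Carrier
    a+b l = a l + b l
    b+a l = b l + a l
    second : ∀ x {y} → f (x ∷ (λ l → x l + y l) ∷ v) ≈ f (x ∷ y ∷ v)
    second x {y} = begin
      f (x ∷ (λ l → x l + y l) ∷ v)
        ≈⟨ linear₀ (alternating-∷ alt x) 1# (λ l → +-congˡ (sym (*-identityˡ (y l)))) ⟩
      f (x ∷ x ∷ v) + 1# * f (x ∷ y ∷ v)
        ≈⟨ +-cong (adjacent alt {zero} {suc zero} ≡.refl (λ l → refl)) (*-identityˡ _) ⟩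
      0# + f (x ∷ y ∷ v)
        ≈⟨ +-identityˡ _ ⟩
      f (x ∷ y ∷ v) ∎

  -- Swaps carry `t` down until it is next to its copy; the signs do not matter because the value is
  -- zero.
  alternating-repeat : ∀ {f : (Fin (suc m) → Fin n → Carrier) → Carrier} → Alternating f →
                       ∀ t i {v} → v i ≋ t → f (t ∷ v) ≈ 0#
  alternating-repeat alt t zero {v} e =
    adjacent alt {zero} {suc zero} ≡.refl (λ l → sym (e l))
  alternating-repeat {f = f} alt t (suc i) {v} e = begin
    f (t ∷ v)                      ≈⟨ uncons (alternating-∷ alt t) v ⟩
    f (t ∷ v zero ∷ v ∘ suc)       ≈⟨ swap alt t (v zero) (v ∘ suc) ⟩
    - f (v zero ∷ t ∷ v ∘ suc)     ≈⟨ -‿cong (alternating-repeat (alternating-∷ alt (v zero)) t i e) ⟩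
    - 0#                           ≈⟨ -0#≈0# ⟩
    0#                             ∎

  -- That `t` is fatal as a row is assumed through `vanish`, so that the hypothesis survives when
  -- the rows are fixed one after the other. In the application `f` already has `t` in a fixed first
  -- slot.
  shear : ∀ {f : (Fin m → Fin n → Carrier) → Carrier} → Alternating f →
          ∀ t → (∀ i {v} → v i ≋ t → f v ≈ 0#) →
          ∀ (s : Fin m → Carrier) {u v} → (∀ i l → u i l ≈ v i l + s i * t l) → f u ≈ f v
  shear {m = zero}  alt t vanish s e = cong alt λ ()
  shear {m = suc m} {f = f} alt t vanish s {u} {v} e = begin
    f u                                                    ≈⟨ uncons alt u ⟩
    f (u zero ∷ u ∘ suc)                                   ≈⟨ linear₀ alt (s zero) (e zero) ⟩
    f (v zero ∷ u ∘ suc) + s zero * f (t ∷ u ∘ suc)        ≈⟨ +-congˡ (*-congˡ (vanish zero λ l → refl)) ⟩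
    f (v zero ∷ u ∘ suc) + s zero * 0#                     ≈⟨ trans (+-congˡ (zeroʳ _)) (+-identityʳ _) ⟩
    f (v zero ∷ u ∘ suc)
      ≈⟨ shear (alternating-∷ alt (v zero)) t (λ i → vanish (suc i)) (s ∘ suc) (e ∘ suc) ⟩
    f (v zero ∷ v ∘ suc)                                   ≈⟨ uncons alt v ⟨
    f v                                                    ∎

  linear-sum : ∀ {f : (Fin (suc m) → Fin n → Carrier) → Carrier} → Alternating f →
               ∀ {p} (a : Fin p → Carrier) (w : Fin p → Fin n → Carrier) v →
               f ((λ l → sum λ j → a j * w j l) ∷ v) ≈ sum (λ j → a j * f (w j ∷ v))
  linear-sum {f = f} alt {zero} a w v = begin
    -- The empty sum is the zero row, written as 0 + (-1) · 0 because linearity speaks of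
    -- combinations u + s v.
    f (0⃗ ∷ v)                          ≈⟨ linear₀ alt (- 1#) (λ l → sym (trans (+-congˡ (zeroʳ _)) (+-identityʳ _))) ⟩
    f (0⃗ ∷ v) + - 1# * f (0⃗ ∷ v)       ≈⟨ +-congˡ (-1*x≈-x _) ⟩
    f (0⃗ ∷ v) - f (0⃗ ∷ v)              ≈⟨ -‿inverseʳ _ ⟩
    0#                                 ∎
    where
    0⃗ : Fin _ → Carrier
    0⃗ l = 0#
  linear-sum {f = f} alt {suc p} a w v = begin
    f ((λ l → sum λ j → a j * w j l) ∷ v)
      ≈⟨ linear₀ alt (a zero) (λ l → +-comm _ _) ⟩
    f ((λ l → sum λ j → a (suc j) * w (suc j) l) ∷ v) + a zero * f (w zero ∷ v)
      ≈⟨ +-congʳ (linear-sum alt (a ∘ suc) (w ∘ suc) v) ⟩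
    sum (λ j → a (suc j) * f (w (suc j) ∷ v)) + a zero * f (w zero ∷ v)
      ≈⟨ +-comm _ _ ⟩
    sum (λ j → a j * f (w j ∷ v)) ∎

  -- Row `j` passes the `toℕ j` rows before it, with one sign for each. This is where the signs of
  -- the Laplace expansion come from.
  alternating-rotate : ∀ {f : (Fin (suc m) → Fin n → Carrier) → Carrier} → Alternating f →
                       ∀ j w → f (w j ∷ w ∘ punchIn j) ≈ (- 1#) ^ toℕ j * f w
  alternating-rotate alt zero w =
    trans (sym (uncons alt w)) (sym (*-identityˡ _))
  alternating-rotate {m = suc m} {f = f} alt (suc j) w = begin
    f (w (suc j) ∷ w ∘ punchIn (suc j))
      ≈⟨ uncons (alternating-∷ alt (w (suc j))) _ ⟩
    f (w (suc j) ∷ w zero ∷ w ∘ suc ∘ punchIn j)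
      ≈⟨ swap alt _ _ _ ⟩
    - f (w zero ∷ w (suc j) ∷ w ∘ suc ∘ punchIn j)
      ≈⟨ -‿cong (alternating-rotate (alternating-∷ alt (w zero)) j (w ∘ suc)) ⟩
    - ((- 1#) ^ toℕ j * f (w zero ∷ w ∘ suc))
      ≈⟨ -‿cong (*-congˡ (uncons alt w)) ⟨
    - ((- 1#) ^ toℕ j * f w)
      ≈⟨ trans (sym (-1*x≈-x _)) (sym (*-assoc _ _ _)) ⟩
    (- 1#) ^ toℕ (suc j) * f w ∎

  minor : Matrix (suc n) → Fin (suc n) → Matrix n
  minor A j i l = A (suc i) (punchIn j l)

  laplaceTerm : Matrix (suc n) → Fin (suc n) → Carrier
  laplaceTerm A j = (- 1#) ^ toℕ j * (A zero j * det (minor A j))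

  -- Induction on the number of rows. Linearity in the first row produces the coefficients
  -- `A zero j`, and the remaining rows, cleared of `w j`, are combinations of the other `w`'s with
  -- coefficient matrix `minor A j`. For `f` = `det` and `w` = `B` this is multiplicativity.
  alternating-det : ∀ {f : (Fin m → Fin n → Carrier) → Carrier} → Alternating f →
                    ∀ (A : Matrix m) (w : Fin m → Fin n → Carrier) →
                    f (λ i l → sum λ j → A i j * w j l) ≈ det A * f w
  alternating-det {m = zero} alt A w = trans (cong alt λ ()) (sym (*-identityˡ _))
  alternating-det {m = suc m} {f = f} alt A w = begin
    f Aw
      ≈⟨ uncons alt Aw ⟩
    f (Aw zero ∷ Aw ∘ suc)
      ≈⟨ linear-sum alt (A zero) w (Aw ∘ suc) ⟩
    sum (λ j → A zero j * f (w j ∷ Aw ∘ suc))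
      ≈⟨ sum-cong-≋ (λ j → trans (*-congˡ (first j))
           (solve 4 (λ a d e x → a :* (d :* (e :* x)) := e :* (a :* d) :* x) refl
             (A zero j) (det (minor A j)) ((- 1#) ^ toℕ j) (f w))) ⟩
    sum (λ j → (- 1#) ^ toℕ j * (A zero j * det (minor A j)) * f w)
      ≈⟨ *-distribʳ-sum (f w) (λ j → (- 1#) ^ toℕ j * (A zero j * det (minor A j))) ⟨
    det A * f w ∎
    where
    Aw : Fin (suc m) → Fin _ → Carrier
    Aw i l = sum λ j → A i j * w j l
    -- With w j in the first slot, its multiples can be dropped from all others.
    first : ∀ j → f (w j ∷ Aw ∘ suc) ≈ det (minor A j) * ((- 1#) ^ toℕ j * f w)
    first j = begin
      f (w j ∷ Aw ∘ suc)
        ≈⟨ shear alt-j (w j) (alternating-repeat alt (w j)) (λ i → A (suc i) j)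
             (λ i l → trans (sum-remove {i = j} (λ j′ → A (suc i) j′ * w j′ l)) (+-comm _ _)) ⟩
      f (w j ∷ λ i l → sum λ p → minor A j i p * w (punchIn j p) l)
        ≈⟨ alternating-det alt-j (minor A j) (w ∘ punchIn j) ⟩
      det (minor A j) * f (w j ∷ w ∘ punchIn j)
        ≈⟨ *-congˡ (alternating-rotate alt j w) ⟩
      det (minor A j) * ((- 1#) ^ toℕ j * f w) ∎
      where
      alt-j : Alternating (λ v → f (w j ∷ v))
      alt-j = alternating-∷ alt (w j)

  -- The Laplace expansion is alternating and multilinear.

  det-cong : {A B : Matrix n} → A ≈ᴹ B → det A ≈ det B
  det-cong {zero}  e = refl
  det-cong {suc n} {A} {B} e = sum-cong (laplaceTerm A) (laplaceTerm B) λ j →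
    *-congˡ {(- 1#) ^ toℕ j} (*-cong (e zero j) (det-cong λ i l → e (suc i) (punchIn j l)))

  private
    -- `P j l` is indexed by the ordered pair of distinct columns `j` and `punchIn j l`, and the
    -- condition is invariance under exchanging the two. The first component treats the pairs
    -- containing column zero; the second shifts the others down by one.
    Symmetric : ∀ n → (Fin (suc n) → Fin n → Carrier) → Set ℓ
    Symmetric zero    P = ⊤
    Symmetric (suc n) P = (∀ l → P zero l ≈ P (suc l) zero) × Symmetric n (λ j l → P (suc j) (suc l))

    signed-sum : (Fin (suc n) → Fin n → Carrier) → Carrier
    signed-sum P = sum λ j → (- 1#) ^ toℕ j * sum λ l → (- 1#) ^ toℕ l * P j l

    -- Columns j < j' occur once as (j , j' - 1) and once as (j' , j) in the indexing of `P`. The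
    -- two signs are opposite, so equal values cancel.
    signed-sum-zero : (P : Fin (suc n) → Fin n → Carrier) → Symmetric n P → signed-sum P ≈ 0#
    signed-sum-zero {zero}  P _ = trans (+-identityʳ _) (zeroʳ _)
    signed-sum-zero {suc n} P (P-sym , P′-sym) = begin
      1# * top + sum (λ j → - 1# * ε j * (1# * P (suc j) zero + sum (λ l → - 1# * ε l * P (suc j) (suc l))))
        ≈⟨ +-cong (*-identityˡ _) 
               (sum-cong-≋ {x = λ j → - 1# * ε j * (1# * P (suc j) zero + sum (λ l → - 1# * ε l * P (suc j) (suc l)))} step) ⟩
      top + sum (λ j → - 1# * (ε j * P zero j) + ε j * inner j)
        ≈⟨ +-congˡ (∑-distrib-+ (λ j → - 1# * (ε j * P zero j)) (λ j → ε j * inner j)) ⟩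
      top + (sum (λ j → - 1# * (ε j * P zero j)) + signed-sum P′)
        ≈⟨ +-congˡ (+-cong (sym (*-distribˡ-sum (- 1#) (λ j → ε j * P zero j))) (signed-sum-zero P′ P′-sym)) ⟩
      top + (- 1# * top + 0#)
        ≈⟨ +-congˡ (trans (+-identityʳ _) (-1*x≈-x top)) ⟩
      top - top
        ≈⟨ -‿inverseʳ top ⟩
      0# ∎
      where
      P′ : Fin (suc n) → Fin n → Carrier
      P′ j l = P (suc j) (suc l)
      ε : ∀ {n} → Fin n → Carrier
      ε j = (- 1#) ^ toℕ j
      top : Carrier
      top = sum λ l → ε l * P zero l
      inner : Fin (suc n) → Carrier
      inner j = sum λ l → ε l * P′ j l
      step : ∀ j → - 1# * ε j * (1# * P (suc j) zero + sum (λ l → - 1# * ε l * P (suc j) (suc l)))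
             ≈ - 1# * (ε j * P zero j) + ε j * inner j
      step j = begin
        - 1# * ε j * (1# * P (suc j) zero + sum (λ l → - 1# * ε l * P′ j l))
          ≈⟨ *-congˡ (+-cong (trans (*-identityˡ _) (sym (P-sym j)))
               (trans (sum-cong-≋ λ l → *-assoc (- 1#) (ε l) (P′ j l))
                      (sym (*-distribˡ-sum (- 1#) (λ l → ε l * P′ j l))))) ⟩
        - 1# * ε j * (P zero j + - 1# * inner j)
          ≈⟨ solve 4 (λ m e p s → m :* e :* (p :+ m :* s) := m :* (e :* p) :+ m :* m :* (e :* s))
               refl (- 1#) (ε j) (P zero j) (inner j) ⟩
        - 1# * (ε j * P zero j) + - 1# * - 1# * (ε j * inner j)
          -- Away from column zero both indices are shifted by one, and the two extra signs multiply
          -- to 1.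
          ≈⟨ +-congˡ (trans (*-congʳ (trans (-1*x≈-x (- 1#)) (-‿involutive 1#))) (*-identityˡ _)) ⟩
        - 1# * (ε j * P zero j) + ε j * inner j ∎

    -- Deleting columns j and then l, or in the other order, gives the same minor.
    minors-symmetric : ∀ n (a : Fin (suc (suc n)) → Carrier) (D : (Fin n → Fin (suc (suc n))) → Carrier) →
      (∀ {ρ τ} → ρ ≗ τ → D ρ ≈ D τ) →
      (P : Fin (suc (suc n)) → Fin (suc n) → Carrier) →
      (∀ j l → P j l ≈ a j * (a (punchIn j l) * D (punchIn j ∘ punchIn l))) → Symmetric (suc n) P
    minors-symmetric n a D D-cong P P-def = first , rest n D D-cong P P-def
      where
      first : ∀ l → P zero l ≈ P (suc l) zero
      first l = begin
        P zero l                                     ≈⟨ P-def zero l ⟩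
        a zero * (a (suc l) * D (suc ∘ punchIn l))   ≈⟨ solve 3 (λ a b d → a :* (b :* d) := b :* (a :* d)) refl _ _ _ ⟩
        a (suc l) * (a zero * D (suc ∘ punchIn l))   ≈⟨ P-def (suc l) zero ⟨
        P (suc l) zero                               ∎
      rest : ∀ n {a : Fin (suc (suc n)) → Carrier} (D : (Fin n → Fin (suc (suc n))) → Carrier) →
        (∀ {ρ τ} → ρ ≗ τ → D ρ ≈ D τ) →
        (P : Fin (suc (suc n)) → Fin (suc n) → Carrier) →
        (∀ j l → P j l ≈ a j * (a (punchIn j l) * D (punchIn j ∘ punchIn l))) →
        Symmetric n (λ j l → P (suc j) (suc l))
      rest zero    _ _ _ _ = tt
      -- When both deleted columns differ from column zero, that column stays in first place:
      -- `punchIn (suc j) ∘ punchIn (suc l)` is `Fin.lift 1` of `punchIn j ∘ punchIn l`. Absorbing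
      -- it into `D` leaves the same problem on the remaining columns.
      rest (suc n) {a} D D-cong P P-def = minors-symmetric n (a ∘ suc) (D ∘ Fin.lift 1)
        (λ e → D-cong λ { zero → ≡.refl ; (suc i) → ≡.cong suc (e i) }) (λ j l → P (suc j) (suc l))
        λ j l → trans (P-def (suc j) (suc l))
          (*-congˡ (*-congˡ (D-cong λ { zero → ≡.refl ; (suc i) → ≡.refl })))

  det-linear : ∀ i s {u v w : Matrix n} → (∀ j → j ≢ i → w j ≋ u j) → (∀ j → j ≢ i → w j ≋ v j) →
               (∀ l → w i l ≈ u i l + s * v i l) → det w ≈ det u + s * det v
  det-linear {suc n} i s {u} {v} {w} eu ev ew = begin
    det w
      ≈⟨ sum-cong (laplaceTerm w) (λ j → laplaceTerm u j + s * laplaceTerm v j) (term i eu ev ew) ⟩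
    sum (λ j → laplaceTerm u j + s * laplaceTerm v j)
      ≈⟨ ∑-distrib-+ (laplaceTerm u) (λ j → s * laplaceTerm v j) ⟩
    det u + sum (λ j → s * laplaceTerm v j)
      ≈⟨ +-congˡ (*-distribˡ-sum s (laplaceTerm v)) ⟨
    det u + s * det v ∎
    where
    term : ∀ i → (∀ j → j ≢ i → w j ≋ u j) → (∀ j → j ≢ i → w j ≋ v j) →
           (∀ l → w i l ≈ u i l + s * v i l) → ∀ j → laplaceTerm w j ≈ laplaceTerm u j + s * laplaceTerm v j
    term zero eu ev ew j = begin
      (- 1#) ^ toℕ j * (w zero j * det (minor w j))
        ≈⟨ *-congˡ (*-congʳ (ew j)) ⟩
      (- 1#) ^ toℕ j * ((u zero j + s * v zero j) * det (minor w j))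
        ≈⟨ solve 5 (λ e a s b d → e :* ((a :+ s :* b) :* d) := e :* (a :* d) :+ s :* (e :* (b :* d)))
             refl ((- 1#) ^ toℕ j) (u zero j) s (v zero j) (det (minor w j)) ⟩
      (- 1#) ^ toℕ j * (u zero j * det (minor w j)) + s * ((- 1#) ^ toℕ j * (v zero j * det (minor w j)))
        ≈⟨ +-cong (*-congˡ (*-congˡ (det-cong λ r l → eu (suc r) (λ ()) _)))
                  (*-congˡ (*-congˡ (*-congˡ (det-cong λ r l → ev (suc r) (λ ()) _)))) ⟩
      laplaceTerm u j + s * laplaceTerm v j ∎
    term (suc i) eu ev ew j = begin
      (- 1#) ^ toℕ j * (w zero j * det (minor w j))
        ≈⟨ *-congˡ (*-congˡ (det-linear i s
             (λ r r≢i l → eu (suc r) (r≢i ∘ suc-injective) _)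
             (λ r r≢i l → ev (suc r) (r≢i ∘ suc-injective) _) (λ l → ew _))) ⟩
      (- 1#) ^ toℕ j * (w zero j * (det (minor u j) + s * det (minor v j)))
        ≈⟨ solve 5 (λ e a s b d → e :* (a :* (b :+ s :* d)) := e :* (a :* b) :+ s :* (e :* (a :* d)))
             refl ((- 1#) ^ toℕ j) (w zero j) s (det (minor u j)) (det (minor v j)) ⟩
      (- 1#) ^ toℕ j * (w zero j * det (minor u j)) + s * ((- 1#) ^ toℕ j * (w zero j * det (minor v j)))
        ≈⟨ +-cong (*-congˡ (*-congʳ (eu zero (λ ()) j)))
                  (*-congˡ (*-congˡ (*-congʳ (ev zero (λ ()) j)))) ⟩
      laplaceTerm u j + s * laplaceTerm v j ∎

  -- Expanding along the first two rows gives a signed sum over ordered pairs of columns. If these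
  -- rows are equal, the product of their entries is symmetric in the pair, as is the minor. A later
  -- adjacent pair is still adjacent in each minor.
  det-adjacent : ∀ i j {A : Matrix n} → toℕ j ≡ suc (toℕ i) → A i ≋ A j → det A ≈ 0#
  det-adjacent {suc (suc n)} zero (suc zero) {A} _ e = begin
    det A
      ≈⟨ sum-cong (laplaceTerm A) (λ j → (- 1#) ^ toℕ j * sum λ l → (- 1#) ^ toℕ l * P j l)
           (λ j → *-congˡ (expand j)) ⟩
    signed-sum P
      ≈⟨ signed-sum-zero P (minors-symmetric n (A zero) D
           (λ e → det-cong λ r l → reflexive (≡.cong (A (suc (suc r))) (e l))) P λ j l → refl) ⟩
    0# ∎
    where
    D : (Fin n → Fin (suc (suc n))) → Carrier
    D ρ = det (λ r l → A (suc (suc r)) (ρ l))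
    P : Fin (suc (suc n)) → Fin (suc n) → Carrier
    P j l = A zero j * (A zero (punchIn j l) * D (punchIn j ∘ punchIn l))
    expand : ∀ j → A zero j * det (minor A j) ≈ sum λ l → (- 1#) ^ toℕ l * P j l
    expand j = begin
      A zero j * det (minor A j)
        ≈⟨ *-distribˡ-sum (A zero j) (laplaceTerm (minor A j)) ⟩
      sum (λ l → A zero j * laplaceTerm (minor A j) l)
        ≈⟨ sum-cong (λ l → A zero j * laplaceTerm (minor A j) l) (λ l → (- 1#) ^ toℕ l * P j l) (λ l → begin
             A zero j * laplaceTerm (minor A j) l
               ≈⟨ *-congˡ (*-congˡ (*-congʳ (e (punchIn j l)))) ⟨
             A zero j * ((- 1#) ^ toℕ l * (A zero (punchIn j l) * D (punchIn j ∘ punchIn l)))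
               ≈⟨ solve 3 (λ a e x → a :* (e :* x) := e :* (a :* x)) refl
                    (A zero j) ((- 1#) ^ toℕ l) (A zero (punchIn j l) * D (punchIn j ∘ punchIn l)) ⟩
             (- 1#) ^ toℕ l * P j l ∎) ⟩
      sum (λ l → (- 1#) ^ toℕ l * P j l) ∎
  det-adjacent (suc i) (suc j) {A} eq e = sum-zero (laplaceTerm A) λ l →
    trans (*-congˡ {(- 1#) ^ toℕ l} (trans
      (*-congˡ (det-adjacent i j {minor A l} (ℕ.suc-injective eq) (λ p → e (punchIn l p)))) (zeroʳ _))) (zeroʳ _)

  det-alternating : Alternating (det {n})
  det-alternating = record
    { cong     = det-cong
    ; linear   = det-linear
    ; adjacent = λ {i} {j} → det-adjacent i j
    }

  det-* : (A B : Matrix n) → det (A *ᴹ B) ≈ det A * det B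
  det-* = alternating-det det-alternating

  -- Identity matrix and sums over split indices.

  1ᴹ-diag : ∀ (i : Fin n) → 1ᴹ i i ≡ 1#
  1ᴹ-diag i = ≡.cong (if_then 1# else 0#) (dec-true (i Fin.≟ i) ≡.refl)

  1ᴹ-off : ∀ {i j : Fin n} → i ≢ j → 1ᴹ i j ≡ 0#
  1ᴹ-off {i = i} {j} i≢j = ≡.cong (if_then 1# else 0#) (dec-false (i Fin.≟ j) i≢j)

  1ᴹ-sym : ∀ (i j : Fin n) → 1ᴹ i j ≡ 1ᴹ j i
  1ᴹ-sym i j = ≡.cong (if_then 1# else 0#) (does-⇔ (mk⇔ ≡.sym ≡.sym) (i Fin.≟ j) (j Fin.≟ i))

  1ᴹ-injective : {π : Fin m → Fin n} → Injective _≡_ _≡_ π → ∀ i j → 1ᴹ (π i) (π j) ≡ 1ᴹ i j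
  1ᴹ-injective {π = π} inj i j =
    ≡.cong (if_then 1# else 0#) (does-⇔ (mk⇔ inj (≡.cong π)) (π i Fin.≟ π j) (i Fin.≟ j))

  sum-1ᴹˡ : ∀ i (t : Fin n → Carrier) → sum (λ j → 1ᴹ i j * t j) ≈ t i
  sum-1ᴹˡ {suc n} i t = begin
    sum (λ j → 1ᴹ i j * t j)
      ≈⟨ sum-remove {i = i} (λ j → 1ᴹ i j * t j) ⟩
    1ᴹ i i * t i + sum (λ j → 1ᴹ i (punchIn i j) * t (punchIn i j))
      ≈⟨ +-cong (trans (*-congʳ (reflexive (1ᴹ-diag i))) (*-identityˡ _))
           (sum-zero _ λ j → trans (*-congʳ (reflexive (1ᴹ-off (punchInᵢ≢i i j ∘ ≡.sym)))) (zeroˡ _)) ⟩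
    t i + 0#
      ≈⟨ +-identityʳ _ ⟩
    t i ∎

  sum-1ᴹʳ : ∀ i (t : Fin n → Carrier) → sum (λ j → t j * 1ᴹ j i) ≈ t i
  sum-1ᴹʳ i t = trans
    (sum-cong-≋ λ j → trans (*-comm _ _) (*-congʳ (reflexive (1ᴹ-sym j i))))
    (sum-1ᴹˡ i t)

  sum-↑ : ∀ m (t : Fin (m ℕ.+ n) → Carrier) →
          sum t ≈ sum (λ i → t (i ↑ˡ n)) + sum (λ j → t (m ↑ʳ j))
  sum-↑ zero    t = sym (+-identityˡ _)
  sum-↑ (suc m) t = trans (+-congˡ (sum-↑ m (t ∘ suc))) (sym (+-assoc _ _ _))

  sum-combine : ∀ k (t : Fin (k ℕ.* n) → Carrier) →
                sum t ≈ sum (λ (i : Fin k) → sum (λ (w : Fin n) → t (combine i w)))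
  sum-combine zero    t = refl
  sum-combine {n} (suc k) t = trans (sum-↑ n t) (+-congˡ (sum-combine k (λ q → t (n ↑ʳ q))))

  -- Determinants of permuted and block matrices.

  det-firstRow : (A : Matrix (suc n)) → (∀ j → A zero (suc j) ≈ 0#) →
                 det A ≈ A zero zero * det (minor A zero)
  det-firstRow A row≈0 = begin
    det A
      ≈⟨ +-cong (*-identityˡ _) (sum-zero (laplaceTerm A ∘ suc) λ j →
           trans (*-congˡ {(- 1#) ^ toℕ (suc j)} (trans (*-congʳ (row≈0 j)) (zeroˡ _))) (zeroʳ _)) ⟩
    A zero zero * det (minor A zero) + 0#
      ≈⟨ +-identityʳ _ ⟩
    A zero zero * det (minor A zero) ∎

  -- The expansion is along rows, so the zero column is handed down: deleting any other column
  -- leaves it in first place.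
  det-zeroColumn : (A : Matrix (suc n)) → (∀ i → A i zero ≈ 0#) → det A ≈ 0#
  det-zeroColumn A col≈0 = sum-zero (laplaceTerm A) λ
    { zero    → trans (*-identityˡ _) (trans (*-congʳ (col≈0 zero)) (zeroˡ _))
    ; (suc j) → minor-zero A col≈0 j }
    where
    minor-zero : (A : Matrix (suc n)) → (∀ i → A i zero ≈ 0#) → ∀ j → laplaceTerm A (suc j) ≈ 0#
    minor-zero {suc n} A col≈0 j = trans
      (*-congˡ {(- 1#) ^ toℕ (suc j)} (trans (*-congˡ (det-zeroColumn (minor A (suc j)) (col≈0 ∘ suc))) (zeroʳ _)))
      (zeroʳ _)

  det-firstColumn : (A : Matrix (suc n)) → (∀ i → A (suc i) zero ≈ 0#) →
                    det A ≈ A zero zero * det (minor A zero)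
  det-firstColumn A col≈0 = begin
    det A
      ≈⟨ +-cong (*-identityˡ _) (sum-zero (laplaceTerm A ∘ suc) (minor-zero A col≈0)) ⟩
    A zero zero * det (minor A zero) + 0#
      ≈⟨ +-identityʳ _ ⟩
    A zero zero * det (minor A zero) ∎
    where
    minor-zero : (A : Matrix (suc n)) → (∀ i → A (suc i) zero ≈ 0#) → ∀ j → laplaceTerm A (suc j) ≈ 0#
    minor-zero {suc n} A col≈0 j = trans
      (*-congˡ {(- 1#) ^ toℕ (suc j)} (trans (*-congˡ (det-zeroColumn (minor A (suc j)) col≈0)) (zeroʳ _)))
      (zeroʳ _)

  det-1ᴹ : ∀ n → det (1ᴹ {n}) ≈ 1#
  det-1ᴹ zero    = refl
  det-1ᴹ (suc n) = trans (det-firstRow (1ᴹ {suc n}) (λ j → refl)) (trans (*-identityˡ _) (det-1ᴹ n))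

  -- Conjugation by permutation matrices `P` and `Q` with P Q = 1: their determinants cancel,
  -- whatever the sign of `π`.
  det-permute : (A : Matrix n) (π : Permutation′ n) →
                det (λ i j → A (π ⟨$⟩ʳ i) (π ⟨$⟩ʳ j)) ≈ det A
  det-permute {n} A π = begin
    det (λ i j → A (π ⟨$⟩ʳ i) (π ⟨$⟩ʳ j))
      ≈⟨ det-cong (λ i j → trans (sum-cong-≋ λ l → *-congʳ (sum-1ᴹˡ (π ⟨$⟩ʳ i) (λ p → A p l)))
           (sum-1ᴹʳ (π ⟨$⟩ʳ j) (A (π ⟨$⟩ʳ i)))) ⟨
    det (P *ᴹ A *ᴹ Q)
      ≈⟨ trans (det-* (P *ᴹ A) Q) (*-congʳ (det-* P A)) ⟩
    det P * det A * det Q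
      ≈⟨ solve 3 (λ p a q → p :* a :* q := p :* q :* a) refl (det P) (det A) (det Q) ⟩
    det P * det Q * det A
      ≈⟨ *-congʳ (det-* P Q) ⟨
    det (P *ᴹ Q) * det A
      ≈⟨ *-congʳ (trans (det-cong PQ≈1) (det-1ᴹ n)) ⟩
    1# * det A
      ≈⟨ *-identityˡ _ ⟩
    det A ∎
    where
    P Q : Matrix n
    P i j = 1ᴹ (π ⟨$⟩ʳ i) j
    Q i j = 1ᴹ i (π ⟨$⟩ʳ j)
    PQ≈1 : P *ᴹ Q ≈ᴹ 1ᴹ
    PQ≈1 i j = trans (sum-1ᴹˡ (π ⟨$⟩ʳ i) (λ l → Q l j))
      (reflexive (1ᴹ-injective (Injection.injective (↔⇒↣ π)) i j))

  -- With zeros at the upper right, only the first `m` columns contribute to the first-row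
  -- expansion, and deleting one of them leaves the lower right block intact.
  det-lowerBlock : ∀ m (N : Matrix (m ℕ.+ n)) → (∀ i j → N (i ↑ˡ n) (m ↑ʳ j) ≈ 0#) →
    det N ≈ det (λ i j → N (i ↑ˡ n) (j ↑ˡ n)) * det (λ i j → N (m ↑ʳ i) (m ↑ʳ j))
  det-lowerBlock zero N _ = sym (*-identityˡ _)
  det-lowerBlock {n} (suc m) N zeros = begin
    det N
      ≈⟨ sum-↑ (suc m) (laplaceTerm N) ⟩
    sum (λ j → laplaceTerm N (j ↑ˡ n)) + sum (λ j → laplaceTerm N (suc m ↑ʳ j))
      ≈⟨ +-cong (sum-cong (λ j → laplaceTerm N (j ↑ˡ n)) (λ j → laplaceTerm L j * det R) left)
           (sum-zero (λ j → laplaceTerm N (suc m ↑ʳ j)) λ j →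
             trans (*-congˡ {(- 1#) ^ toℕ (suc m ↑ʳ j)} (trans (*-congʳ (zeros zero j)) (zeroˡ _))) (zeroʳ _)) ⟩
    sum (λ j → laplaceTerm L j * det R) + 0#
      ≈⟨ trans (+-identityʳ _) (sym (*-distribʳ-sum (det R) (laplaceTerm L))) ⟩
    det L * det R ∎
    where
    L : Matrix (suc m)
    L i j = N (i ↑ˡ n) (j ↑ˡ n)
    R : Matrix n
    R i j = N (suc m ↑ʳ i) (suc m ↑ʳ j)
    left : ∀ j → laplaceTerm N (j ↑ˡ n) ≈ laplaceTerm L j * det R
    left j = begin
      (- 1#) ^ toℕ (j ↑ˡ n) * (L zero j * det (minor N (j ↑ˡ n)))
        ≈⟨ *-cong (reflexive (≡.cong ((- 1#) ^_) (toℕ-↑ˡ j n))) (*-congˡ (begin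
             det (minor N (j ↑ˡ n))
               ≈⟨ det-lowerBlock m (minor N (j ↑ˡ n)) (λ i l →
                    trans (entry (suc (i ↑ˡ n)) (punchIn-↑ʳ j l)) (zeros (suc i) l)) ⟩
             det (λ i l → minor N (j ↑ˡ n) (i ↑ˡ n) (l ↑ˡ n)) * det (λ i l → minor N (j ↑ˡ n) (m ↑ʳ i) (m ↑ʳ l))
               ≈⟨ *-cong (det-cong λ i l → entry (suc (i ↑ˡ n)) (punchIn-↑ˡ j l))
                         (det-cong λ i l → entry (suc (m ↑ʳ i)) (punchIn-↑ʳ j l)) ⟩
             det (minor L j) * det R ∎)) ⟩
      (- 1#) ^ toℕ j * (L zero j * (det (minor L j) * det R))
        ≈⟨ solve 4 (λ e a m d → e :* (a :* (m :* d)) := e :* (a :* m) :* d) refl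
             ((- 1#) ^ toℕ j) (L zero j) (det (minor L j)) (det R) ⟩
      laplaceTerm L j * det R ∎
      where
      entry : ∀ i {l l′} → l ≡ l′ → N i l ≈ N i l′
      entry i e = reflexive (≡.cong (N i) e)

  -- Serves to compute the determinant of the elimination matrix, whose zeros lie at the lower left.
  -- The columns of the identity block are removed from the left, each with pivot 1.
  det-upperUnit : ∀ m (N : Matrix (m ℕ.+ n)) →
    (∀ i j → N (i ↑ˡ n) (j ↑ˡ n) ≈ 1ᴹ i j) → (∀ i j → N (m ↑ʳ i) (j ↑ˡ n) ≈ 0#) →
    det N ≈ det (λ i j → N (m ↑ʳ i) (m ↑ʳ j))
  det-upperUnit zero N _ _ = refl
  det-upperUnit {n} (suc m) N units zeros = begin
    det N
      ≈⟨ det-firstColumn N (↑-elim m _ (λ i → units (suc i) zero) (λ i → zeros i zero)) ⟩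
    N zero zero * det (minor N zero)
      ≈⟨ trans (*-congʳ (units zero zero)) (*-identityˡ _) ⟩
    det (minor N zero)
      ≈⟨ det-upperUnit m (minor N zero) (λ i j → units (suc i) (suc j)) (λ i j → zeros i (suc j)) ⟩
    det (λ i j → N (suc m ↑ʳ i) (suc m ↑ʳ j)) ∎

  -- U = (I Y; 0 I) has determinant 1, and U N is block lower triangular.
  det-schur : ∀ m (N : Matrix (m ℕ.+ n)) (Y : Fin m → Fin n → Carrier) →
    (∀ i j → N (i ↑ˡ n) (m ↑ʳ j) + sum (λ q → Y i q * N (m ↑ʳ q) (m ↑ʳ j)) ≈ 0#) →
    det N ≈ det (λ i j → N (i ↑ˡ n) (j ↑ˡ n) + sum (λ q → Y i q * N (m ↑ʳ q) (j ↑ˡ n)))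
            * det (λ i j → N (m ↑ʳ i) (m ↑ʳ j))
  det-schur {n} m N Y eliminated = begin
    det N
      ≈⟨ *-identityˡ _ ⟨
    1# * det N
      ≈⟨ *-congʳ (trans (det-upperUnit m U (λ i j → reflexive (U-ˡ i (j ↑ˡ n) (splitAt-↑ˡ m j n)))
                   (λ i j → reflexive (U-ʳ i (j ↑ˡ n) (splitAt-↑ˡ m j n))))
           (trans (det-cong λ i j → reflexive (U-ʳ i (m ↑ʳ j) (splitAt-↑ʳ m n j))) (det-1ᴹ n))) ⟨
    det U * det N
      ≈⟨ det-* U N ⟨
    det (U *ᴹ N)
      ≈⟨ det-lowerBlock m (U *ᴹ N) (λ i j → trans (upper i (m ↑ʳ j)) (eliminated i j)) ⟩
    det (λ i j → (U *ᴹ N) (i ↑ˡ n) (j ↑ˡ n)) * det (λ i j → (U *ᴹ N) (m ↑ʳ i) (m ↑ʳ j))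
      ≈⟨ *-cong (det-cong λ i j → upper i (j ↑ˡ n)) (det-cong λ i j → lower i (m ↑ʳ j)) ⟩
    det (λ i j → N (i ↑ˡ n) (j ↑ˡ n) + sum (λ q → Y i q * N (m ↑ʳ q) (j ↑ˡ n)))
      * det (λ i j → N (m ↑ʳ i) (m ↑ʳ j)) ∎
    where
    block : Fin m ⊎ Fin n → Fin m ⊎ Fin n → Carrier
    block (inj₁ i) (inj₁ j) = 1ᴹ i j
    block (inj₁ i) (inj₂ q) = Y i q
    block (inj₂ p) (inj₁ j) = 0#
    block (inj₂ p) (inj₂ q) = 1ᴹ p q
    U : Matrix (m ℕ.+ n)
    U i j = block (splitAt m i) (splitAt m j)
    U-ˡ : ∀ i b {s} → splitAt m b ≡ s → U (i ↑ˡ n) b ≡ block (inj₁ i) s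
    U-ˡ i b = ≡.cong₂ block (splitAt-↑ˡ m i n)
    U-ʳ : ∀ i b {s} → splitAt m b ≡ s → U (m ↑ʳ i) b ≡ block (inj₂ i) s
    U-ʳ i b = ≡.cong₂ block (splitAt-↑ʳ m n i)
    upper : ∀ i b → (U *ᴹ N) (i ↑ˡ n) b ≈ N (i ↑ˡ n) b + sum (λ q → Y i q * N (m ↑ʳ q) b)
    upper i b = trans (sum-↑ m (λ a → U (i ↑ˡ n) a * N a b)) (+-cong
      (trans (sum-cong-≋ λ j → *-congʳ (reflexive (U-ˡ i (j ↑ˡ n) (splitAt-↑ˡ m j n))))
             (sum-1ᴹˡ i (λ j → N (j ↑ˡ n) b)))
      (sum-cong-≋ λ q → *-congʳ (reflexive (U-ˡ i (m ↑ʳ q) (splitAt-↑ʳ m n q)))))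
    lower : ∀ i b → (U *ᴹ N) (m ↑ʳ i) b ≈ N (m ↑ʳ i) b
    lower i b = begin
      (U *ᴹ N) (m ↑ʳ i) b
        ≈⟨ sum-↑ m (λ a → U (m ↑ʳ i) a * N a b) ⟩
      sum (λ j → U (m ↑ʳ i) (j ↑ˡ n) * N (j ↑ˡ n) b) + sum (λ q → U (m ↑ʳ i) (m ↑ʳ q) * N (m ↑ʳ q) b)
        ≈⟨ +-cong (sum-zero _ λ j → trans (*-congʳ (reflexive (U-ʳ i (j ↑ˡ n) (splitAt-↑ˡ m j n)))) (zeroˡ _))
             (sum-cong-≋ λ q → *-congʳ (reflexive (U-ʳ i (m ↑ʳ q) (splitAt-↑ʳ m n q)))) ⟩
      0# + sum (λ q → 1ᴹ i q * N (m ↑ʳ q) b)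
        ≈⟨ trans (+-identityˡ _) (sum-1ᴹˡ i (λ q → N (m ↑ʳ q) b)) ⟩
      N (m ↑ʳ i) b ∎

  -- `combine zero w` unfolds to `w ↑ˡ (k ℕ.* n)` and `combine (suc i) w` to `n ↑ʳ combine i w`, so
  -- the first copy of `D` is split off as a block and the others form the same matrix for `k`.
  det-blockDiagonal : ∀ k (D : Matrix n) (N : Matrix (k ℕ.* n)) →
    (∀ (i j : Fin k) w z → N (combine i w) (combine j z) ≈ 1ᴹ i j * D w z) → det N ≈ det D ^ k
  det-blockDiagonal zero D N _ = refl
  det-blockDiagonal {n} (suc k) D N blocks = begin
    det N
      ≈⟨ det-lowerBlock n N zeros ⟩
    det (λ w z → N (w ↑ˡ (k ℕ.* n)) (z ↑ˡ (k ℕ.* n))) * det (λ p q → N (n ↑ʳ p) (n ↑ʳ q))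
      ≈⟨ *-cong (det-cong λ w z → trans (blocks zero zero w z) (*-identityˡ _))
                (det-blockDiagonal k D _ λ i j → blocks (suc i) (suc j)) ⟩
    det D * det D ^ k ∎
    where
    zeros : ∀ w q → N (w ↑ˡ (k ℕ.* n)) (n ↑ʳ q) ≈ 0#
    zeros w q with combine-surjective {k} {n} q
    ... | j , z , ≡.refl = trans (blocks zero (suc j) w z) (zeroˡ _)

-- Determinants under ring homomorphisms.

module _ {r ℓ₁ s ℓ₂} (R : CommutativeRing r ℓ₁) (S : CommutativeRing s ℓ₂) where
  private
    module R = CommutativeRing R
    module S = CommutativeRing S
    module Mᴿ = MatrixOver R
    module Mˢ = MatrixOver S

  module _ {φ : R.Carrier → S.Carrier} (φ-homo : IsRingHomomorphism R.rawRing S.rawRing φ) where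
    open IsRingHomomorphism φ-homo

    sum-homo : (t : Fin n → R.Carrier) → φ (Mᴿ.sum t) S.≈ Mˢ.sum (φ ∘ t)
    sum-homo {zero}  t = 0#-homo
    sum-homo {suc n} t = S.trans (+-homo _ _) (S.+-congˡ (sum-homo (t ∘ suc)))

    ^-homo : ∀ a k → φ (a Mᴿ.^ k) S.≈ φ a Mˢ.^ k
    ^-homo a zero    = 1#-homo
    ^-homo a (suc k) = S.trans (*-homo _ _) (S.*-congˡ (^-homo a k))

    1ᴹ-homo : ∀ (i j : Fin n) → φ (Mᴿ.1ᴹ i j) S.≈ Mˢ.1ᴹ i j
    1ᴹ-homo i j with does (i Fin.≟ j)
    ... | true  = 1#-homo
    ... | false = 0#-homo

    det-homo : (B : Mᴿ.Matrix n) → φ (Mᴿ.det B) S.≈ Mˢ.det (λ i j → φ (B i j))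
    det-homo {zero}  B = 1#-homo
    det-homo {suc n} B = S.trans (sum-homo term) (Mˢ.sum-cong-≋ {x = φ ∘ term} λ j →
      S.trans (*-homo ((R.- R.1#) Mᴿ.^ toℕ j) _)
        (S.*-cong
          (S.trans (^-homo (R.- R.1#) (toℕ j))
            (Expˢ.^-congˡ (toℕ j) (S.trans (-‿homo R.1#) (S.-‿cong 1#-homo))))
          (S.trans (*-homo (B zero j) _) (S.*-congˡ (det-homo (λ i l → B (suc i) (punchIn j l)))))))
      where
      module Expˢ = Algebra.Properties.Semiring.Exp S.semiring
      term : Fin (suc n) → R.Carrier
      term j = (R.- R.1#) Mᴿ.^ toℕ j R.* (B zero j R.* Mᴿ.det (λ i l → B (suc i) (punchIn j l)))

-- A vertex of full degree.

∣tabulate∣-punchIn : ∀ (p : Fin (suc n) → Bool) i → p i ≡ false →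
                     ∣ tabulate p ∣ ≡ ∣ tabulate (p ∘ punchIn i) ∣
∣tabulate∣-punchIn p zero eq rewrite eq = ≡.refl
∣tabulate∣-punchIn {suc n} p (suc i) eq with p zero
... | true  = ≡.cong suc (∣tabulate∣-punchIn (p ∘ suc) i eq)
... | false = ∣tabulate∣-punchIn (p ∘ suc) i eq

-- By irreflexivity `u` itself adds nothing to its degree, so all `n` neighbours lie among the `n`
-- other vertices, and a subset of full size is everything.
dominating : ∀ (H : Graph (suc n)) u → degree H u ≡ n → ∀ w → adj H u (punchIn u w) ≡ true
dominating H u deg w = begin
  adj H u (punchIn u w)                                ≡⟨ lookup∘tabulate _ w ⟨
  lookup (tabulate (λ w → adj H u (punchIn u w))) w    ≡⟨ ≡.cong (λ p → lookup p w) (∣p∣≡n⇒p≡⊤ {p = tabulate (adj H u ∘ punchIn u)}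
    (≡.trans (≡.sym (∣tabulate∣-punchIn (adj H u) u (adj-irrefl H u))) deg)) ⟩
  lookup ⊤ˢ w                                          ≡⟨ lookup-replicate w true ⟩
  true                                                 ∎
  where open ≡.≡-Reasoning

-- α is the embedding of adjacency matrix entries into K.
module Characteristic (K : CommutativeRing c ℓ) (α : Bool → CommutativeRing.Carrier K)
  (α-true : CommutativeRing._≈_ K (α true) (CommutativeRing.1# K))
  (α-false : CommutativeRing._≈_ K (α false) (CommutativeRing.0# K))
  (x : CommutativeRing.Carrier K) where

  open CommutativeRing K hiding (zero)
  open MatrixOver K
  open Determinant K
  open Algebra.Properties.Ring ring
  open Relation.Binary.Reasoning.Setoid setoid
  open Algebra.Solver.Ring.NaturalCoefficients.Default commutativeSemiring
    using (solve; _:+_; _:*_; _:=_)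

  charMatrix : Graph n → Matrix n
  charMatrix G = x I- λ i j → α (adj G i j)

  private
    [_] : Bool → Carrier
    [ b ] = if b then 1# else 0#

    α-∧ : ∀ b d → α (b ∧ d) ≈ [ b ] * α d
    α-∧ true  d = sym (*-identityˡ _)
    α-∧ false d = trans α-false (sym (zeroˡ _))

    []-∧ : ∀ b d → [ b ∧ d ] ≈ [ b ] * [ d ]
    []-∧ true  d = sym (*-identityˡ _)
    []-∧ false d = sym (zeroˡ _)

  1ᴹ-combine : ∀ {k h} (i j : Fin k) (w z : Fin h) → 1ᴹ (combine i w) (combine j z) ≈ 1ᴹ i j * 1ᴹ w z
  1ᴹ-combine i j w z = trans
    (reflexive (≡.cong [_] (does-⇔
      (mk⇔ (combine-injective i w j z) λ { (≡.refl , ≡.refl) → ≡.refl })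
      (combine i w Fin.≟ combine j z) ((i Fin.≟ j) ×-dec (w Fin.≟ z)))))
    ([]-∧ (does (i Fin.≟ j)) (does (w Fin.≟ z)))

  sum-separate : ∀ {k h} (p s : Fin k → Carrier) (r d : Fin h → Carrier) →
    sum (λ i → sum (λ w → p i * r w * (s i * d w))) ≈ sum (λ i → p i * s i) * sum (λ w → r w * d w)
  sum-separate p s r d = begin
    sum (λ i → sum (λ w → p i * r w * (s i * d w)))
      ≈⟨ sum-cong-≋ (λ i → trans
           (sum-cong-≋ λ w → solve 4 (λ p r s d → p :* r :* (s :* d) := p :* s :* (r :* d)) refl
             (p i) (r w) (s i) (d w))
           (sym (*-distribˡ-sum (p i * s i) (λ w → r w * d w)))) ⟩
    sum (λ i → p i * s i * sum (λ w → r w * d w))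
      ≈⟨ *-distribʳ-sum (sum λ w → r w * d w) (λ i → p i * s i) ⟨
    sum (λ i → p i * s i) * sum (λ w → r w * d w) ∎

  -- The characteristic matrix of the graph with pockets and its Schur complement.

  module _ {n k h} (F : Graph n) (v : Fin k → Fin n) (H : Graph (suc h)) (u : Fin (suc h))
           (u-dominates : ∀ w → adj H u (punchIn u w) ≡ true)
           (D⁻¹ : Inverse (charMatrix (H ─ u))) where

    open Inverse D⁻¹ renaming (matrix to E)
    open Pockets F v H u

    private
      N : Matrix (n ℕ.+ k ℕ.* h)
      N = charMatrix (pockets F v H u)

      D : Matrix h
      D = charMatrix (H ─ u)

      -- The factors `1#` are kept so that this is definitionally `Γ` when `K` is `ℚ⟨x⟩` and the
      -- inverse is the one used in `Γ`.
      γ : Carrier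
      γ = sum {h} λ i → sum {h} λ j → 1# * E i j * 1#

      inF : Fin n → Fin (n ℕ.+ k ℕ.* h)
      inF a = a ↑ˡ (k ℕ.* h)

      inP : Fin k → Fin h → Fin (n ℕ.+ k ℕ.* h)
      inP i w = n ↑ʳ combine i w

      vertex-inF : ∀ a → vertex (inF a) ≡ inj₁ a
      vertex-inF a = ≡.cong (map₂ (remQuot h)) (splitAt-↑ˡ n a (k ℕ.* h))

      vertex-inP : ∀ i w → vertex (inP i w) ≡ inj₂ (i , w)
      vertex-inP i w = ≡.trans
        (≡.cong (map₂ (remQuot h)) (splitAt-↑ʳ n (k ℕ.* h) (combine i w)))
        (≡.cong inj₂ (remQuot-combine i w))

      α-vertex : ∀ {a b s t} → vertex a ≡ s → vertex b ≡ t → α (vadj (vertex a) (vertex b)) ≈ α (vadj s t)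
      α-vertex ea eb = reflexive (≡.cong₂ (λ s t → α (vadj s t)) ea eb)

      disjoint : ∀ a q → inF a ≢ n ↑ʳ q
      disjoint a q eq with () ←
        ≡.trans (≡.sym (splitAt-↑ˡ n a (k ℕ.* h))) (≡.trans (≡.cong (splitAt n) eq) (splitAt-↑ʳ n (k ℕ.* h) q))

      N-FF : ∀ a b → N (inF a) (inF b) ≈ x * 1ᴹ a b - α (adj F a b)
      N-FF a b = +-cong (*-congˡ (reflexive (1ᴹ-injective (↑ˡ-injective (k ℕ.* h) _ _) a b)))
        (-‿cong (α-vertex {inF a} {inF b} (vertex-inF a) (vertex-inF b)))

      off-diagonal : ∀ {a b} i c → a ≢ b → α (vadj (vertex a) (vertex b)) ≈ 1ᴹ c (v i) → N a b ≈ - 1ᴹ c (v i)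
      off-diagonal i c a≢b e =
        trans (+-cong (trans (*-congˡ (reflexive (1ᴹ-off a≢b))) (zeroʳ x)) (-‿cong e)) (+-identityˡ _)

      α-neighbour : ∀ c i {b} → b ≡ true → α (does (c Fin.≟ v i) ∧ b) ≈ 1ᴹ c (v i)
      α-neighbour c i ≡.refl = trans (α-∧ (does (c Fin.≟ v i)) true) (trans (*-congˡ α-true) (*-identityʳ _))

      N-FP : ∀ a i w → N (inF a) (inP i w) ≈ - 1ᴹ a (v i)
      N-FP a i w = off-diagonal i a (disjoint a (combine i w))
        (trans (α-vertex {inF a} {inP i w} (vertex-inF a) (vertex-inP i w)) (α-neighbour a i (u-dominates w)))

      N-PF : ∀ i w a → N (inP i w) (inF a) ≈ - 1ᴹ a (v i)
      N-PF i w a = off-diagonal i a (disjoint a (combine i w) ∘ ≡.sym)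
        (trans (α-vertex {inP i w} {inF a} (vertex-inP i w) (vertex-inF a))
          (α-neighbour a i (≡.trans (adj-sym H (punchIn u w) u) (u-dominates w))))

      N-PP : ∀ i j w z → N (inP i w) (inP j z) ≈ 1ᴹ i j * D w z
      N-PP i j w z = begin
        x * 1ᴹ (inP i w) (inP j z) - α (vadj (vertex (inP i w)) (vertex (inP j z)))
          ≈⟨ +-cong
               (*-congˡ (trans (reflexive (1ᴹ-injective (↑ʳ-injective n _ _) (combine i w) (combine j z)))
                               (1ᴹ-combine i j w z)))
               (-‿cong (trans (α-vertex {inP i w} {inP j z} (vertex-inP i w) (vertex-inP j z))
                              (α-∧ (does (i Fin.≟ j)) _))) ⟩
        x * (1ᴹ i j * 1ᴹ w z) - 1ᴹ i j * α (adj (H ─ u) w z)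
          ≈⟨ +-cong (solve 3 (λ x e d → x :* (e :* d) := e :* (x :* d)) refl x (1ᴹ i j) (1ᴹ w z))
                    (-‿distribʳ-* _ _) ⟩
        1ᴹ i j * (x * 1ᴹ w z) + 1ᴹ i j * - α (adj (H ─ u) w z)
          ≈⟨ distribˡ _ _ _ ⟨
        1ᴹ i j * D w z ∎

      r : Fin h → Carrier
      r w = sum λ z → E z w

      Y : Fin n → Fin (k ℕ.* h) → Carrier
      Y a q = 1ᴹ a (v (quotient h q)) * r (remainder {k} h q)

      -- Row a of `Y` and the columns of `N` below `F` are products of a factor in the pocket and a
      -- factor in the vertex within it, so the sum splits. `d` is a column of `D` for a column in a
      -- pocket, and constantly 1 for a column of `F`.
      Y-sum : ∀ a b (s : Fin k → Carrier) (d : Fin h → Carrier) → (∀ i w → N (inP i w) b ≈ s i * d w) →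
              sum (λ q → Y a q * N (n ↑ʳ q) b) ≈ sum (λ i → 1ᴹ a (v i) * s i) * sum (λ w → r w * d w)
      Y-sum a b s d e = begin
        sum (λ q → Y a q * N (n ↑ʳ q) b)
          ≈⟨ sum-combine k (λ q → Y a q * N (n ↑ʳ q) b) ⟩
        sum (λ i → sum λ w → Y a (combine i w) * N (inP i w) b)
          ≈⟨ sum-cong-≋ (λ i → sum-cong-≋ λ w → *-cong
               (reflexive (≡.cong (λ (i , w) → 1ᴹ a (v i) * r w) (remQuot-combine i w))) (e i w)) ⟩
        sum (λ i → sum λ w → 1ᴹ a (v i) * r w * (s i * d w))
          ≈⟨ sum-separate (λ i → 1ᴹ a (v i)) s r d ⟩
        sum (λ i → 1ᴹ a (v i) * s i) * sum (λ w → r w * d w) ∎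

      rD≈1 : ∀ z → sum (λ w → r w * D w z) ≈ 1#
      rD≈1 z = begin
        sum (λ w → sum (λ y → E y w) * D w z)
          ≈⟨ sum-cong-≋ (λ w → *-distribʳ-sum (D w z) (λ y → E y w)) ⟩
        sum (λ w → sum (λ y → E y w * D w z))
          ≈⟨ ∑-comm (λ w y → E y w * D w z) ⟩
        sum (λ y → (E *ᴹ D) y z)
          ≈⟨ sum-cong-≋ (λ y → trans (inverseˡ y z) (sym (*-identityˡ _))) ⟩
        sum (λ y → 1# * 1ᴹ y z)
          ≈⟨ sum-1ᴹʳ z (λ y → 1#) ⟩
        1# ∎

      r1≈γ : sum (λ w → r w * 1#) ≈ γ
      r1≈γ = begin
        sum (λ w → sum (λ z → E z w) * 1#)
          ≈⟨ sum-cong-≋ (λ w → *-identityʳ (r w)) ⟩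
        sum (λ w → sum (λ z → E z w))
          ≈⟨ ∑-comm (λ w z → E z w) ⟩
        sum (λ z → sum (λ w → E z w))
          ≈⟨ sum-cong (λ z → sum λ w → 1# * E z w * 1#) (λ z → sum λ w → E z w)
               (λ z → sum-cong (λ w → 1# * E z w * 1#) (λ w → E z w) λ w → trans (*-identityʳ _) (*-identityˡ _)) ⟨
        γ ∎

      eliminated : ∀ a q → N (inF a) (n ↑ʳ q) + sum (λ q′ → Y a q′ * N (n ↑ʳ q′) (n ↑ʳ q)) ≈ 0#
      eliminated a q with combine-surjective {k} {h} q
      ... | j , z , ≡.refl = begin
        N (inF a) (inP j z) + sum (λ q′ → Y a q′ * N (n ↑ʳ q′) (inP j z))
          ≈⟨ +-cong (N-FP a j z) (Y-sum a (inP j z) (λ i → 1ᴹ i j) (λ w → D w z) λ i w → N-PP i j w z) ⟩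
        - 1ᴹ a (v j) + sum (λ i → 1ᴹ a (v i) * 1ᴹ i j) * sum (λ w → r w * D w z)
          ≈⟨ +-congˡ (trans (*-cong (sum-1ᴹʳ j (λ i → 1ᴹ a (v i))) (rD≈1 z)) (*-identityʳ _)) ⟩
        - 1ᴹ a (v j) + 1ᴹ a (v j)
          ≈⟨ -‿inverseˡ _ ⟩
        0# ∎

      S : Matrix n
      S a b = N (inF a) (inF b) + sum (λ q → Y a q * N (n ↑ʳ q) (inF b))

      -- The sum over `i` counts the pockets attached at `a` when `a` equals `b`, and is zero
      -- otherwise. That it is at most 1 enters later, with the injectivity of `v`.
      S-entry : ∀ a b → S a b ≈ x * 1ᴹ a b - (α (adj F a b) + γ * sum (λ i → 1ᴹ a (v i) * 1ᴹ b (v i)))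
      S-entry a b = begin
        N (inF a) (inF b) + sum (λ q → Y a q * N (n ↑ʳ q) (inF b))
          ≈⟨ +-cong (N-FF a b) (Y-sum a (inF b) (λ i → - 1ᴹ b (v i)) (λ w → 1#)
               λ i w → trans (N-PF i w b) (sym (*-identityʳ _))) ⟩
        x * 1ᴹ a b - α (adj F a b) + sum (λ i → 1ᴹ a (v i) * - 1ᴹ b (v i)) * sum (λ w → r w * 1#)
          ≈⟨ +-congˡ (*-cong (begin
               sum (λ i → 1ᴹ a (v i) * - 1ᴹ b (v i))
                 ≈⟨ sum-cong (λ i → 1ᴹ a (v i) * - 1ᴹ b (v i)) (λ i → - 1# * (1ᴹ a (v i) * 1ᴹ b (v i)))
                      (λ i → trans (sym (-‿distribʳ-* _ _)) (sym (-1*x≈-x _))) ⟩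
               sum (λ i → - 1# * (1ᴹ a (v i) * 1ᴹ b (v i)))
                 ≈⟨ *-distribˡ-sum (- 1#) (λ i → 1ᴹ a (v i) * 1ᴹ b (v i)) ⟨
               - 1# * μ
                 ≈⟨ -1*x≈-x μ ⟩
               - μ ∎) r1≈γ) ⟩
        x * 1ᴹ a b - α (adj F a b) + - μ * γ
          ≈⟨ +-congˡ (trans (sym (-‿distribˡ-* μ γ)) (-‿cong (*-comm μ γ))) ⟩
        x * 1ᴹ a b - α (adj F a b) - γ * μ
          ≈⟨ trans (+-assoc _ _ _) (+-congˡ (-‿+-comm _ _)) ⟩
        x * 1ᴹ a b - (α (adj F a b) + γ * μ) ∎
        where
        μ : Carrier
        μ = sum λ i → 1ᴹ a (v i) * 1ᴹ b (v i)

    -- Putting the pocket vertices first.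

    module _ (v-injective : Injective _≡_ _≡_ v)
             (σ : Permutation′ n) (σv : ∀ i → toℕ (σ ⟨$⟩ˡ v i) ≡ toℕ i) where

      private
        -- `σ ⟨$⟩ˡ v i` is the new position of `v i`. A position below `k` is thus held by exactly
        -- one `v i`, the one with the same number, and the other positions by none. The decision is
        -- an argument so that matching on it reduces the conditional of `blockI`.
        corner : ∀ p q (p<k? : Dec (toℕ p ℕ.< k)) →
          sum (λ i → 1ᴹ (σ ⟨$⟩ʳ p) (v i) * 1ᴹ (σ ⟨$⟩ʳ q) (v i)) ≈ (if does p<k? then 1ᴹ p q else 0#)
        corner p q (yes p<k) = begin
          sum (λ i → 1ᴹ (σ ⟨$⟩ʳ p) (v i) * 1ᴹ (σ ⟨$⟩ʳ q) (v i))
            ≈⟨ sum-cong-≋ (λ i → *-congʳ {1ᴹ (σ ⟨$⟩ʳ q) (v i)} (reflexive (≡.trans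
                 (≡.cong (λ a → 1ᴹ a (v i)) (≡.sym vᵢ≡σp)) (1ᴹ-injective v-injective (Fin.fromℕ< p<k) i)))) ⟩
          sum (λ i → 1ᴹ (Fin.fromℕ< p<k) i * 1ᴹ (σ ⟨$⟩ʳ q) (v i))
            ≈⟨ sum-1ᴹˡ (Fin.fromℕ< p<k) (λ i → 1ᴹ (σ ⟨$⟩ʳ q) (v i)) ⟩
          1ᴹ (σ ⟨$⟩ʳ q) (v (Fin.fromℕ< p<k))
            ≡⟨ ≡.cong (1ᴹ (σ ⟨$⟩ʳ q)) vᵢ≡σp ⟩
          1ᴹ (σ ⟨$⟩ʳ q) (σ ⟨$⟩ʳ p)
            ≡⟨ ≡.trans (1ᴹ-injective (Injection.injective (↔⇒↣ σ)) q p) (1ᴹ-sym q p) ⟩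
          1ᴹ p q ∎
          where
          vᵢ≡σp : v (Fin.fromℕ< p<k) ≡ σ ⟨$⟩ʳ p
          vᵢ≡σp = ≡.trans (≡.sym (Perm.inverseʳ σ))
            (≡.cong (σ ⟨$⟩ʳ_) (Fin.toℕ-injective (≡.trans (σv _) (Fin.toℕ-fromℕ< p<k))))
        corner p q (no p≮k) = sum-zero _ λ i →
          trans (*-congʳ (reflexive (1ᴹ-off (λ σp≡vᵢ → p≮k (≡.subst (ℕ._< k)
            (≡.trans (≡.sym (σv i)) (≡.cong toℕ (≡.trans (≡.cong (σ ⟨$⟩ˡ_) (≡.sym σp≡vᵢ)) (Perm.inverseˡ σ))))
            (Fin.toℕ<n i)))))) (zeroˡ _)

      det-pockets : det (charMatrix (pockets F v H u)) ≈
        det (charMatrix (H ─ u)) ^ k *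
        det (x I- λ i j → α (adj (reorder σ F) i j) + γ * blockI k i j)
      det-pockets = begin
        det N
          ≈⟨ det-schur n N Y eliminated ⟩
        det S * det (λ p q → N (n ↑ʳ p) (n ↑ʳ q))
          ≈⟨ *-comm _ _ ⟩
        det (λ p q → N (n ↑ʳ p) (n ↑ʳ q)) * det S
          -- The reordering is applied only to the n × n Schur complement; the graph with pockets
          -- keeps the given order of `F`.
          ≈⟨ *-cong (det-blockDiagonal k D (λ p q → N (n ↑ʳ p) (n ↑ʳ q)) N-PP) (sym (det-permute S σ)) ⟩
        det D ^ k * det (λ i j → S (σ ⟨$⟩ʳ i) (σ ⟨$⟩ʳ j))
          ≈⟨ *-congˡ (det-cong λ i j → trans (S-entry (σ ⟨$⟩ʳ i) (σ ⟨$⟩ʳ j)) (+-cong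
               (*-congˡ (reflexive (1ᴹ-injective (Injection.injective (↔⇒↣ σ)) i j)))
               (-‿cong (+-congˡ (*-congˡ (corner i j (toℕ i ℕ.<? k))))))) ⟩
        det D ^ k * det (x I- λ i j → α (adj (reorder σ F) i j) + γ * blockI k i j) ∎

-- From polynomials to rational functions.

module _ (D : CommutativeRing c ℓ) (dom : IsDomain D) where
  open CommutativeRing D
  open FractionField D dom using (fractionField; cross) renaming (ι to fraction)

  ι-isRingHomomorphism : IsRingHomomorphism rawRing (CommutativeRing.rawRing fractionField) fraction
  ι-isRingHomomorphism = record
    { isSemiringHomomorphism = record
      { isNearSemiringHomomorphism = record
        { +-isMonoidHomomorphism = record
          { isMagmaHomomorphism = record
            { isRelHomomorphism = record { cong = λ e → cross (*-congʳ e) }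
            ; homo = λ a b → cross (trans (*-congˡ (*-identityˡ 1#))
                (*-congʳ (sym (+-cong (*-identityʳ a) (*-identityʳ b)))))
            }
          ; ε-homo = cross refl
          }
        ; *-homo = λ a b → cross (*-congˡ (*-identityˡ 1#))
        }
      ; 1#-homo = cross refl
      }
    ; -‿homo = λ a → cross refl
    }

open CommutativeRing ℚ⟨x⟩ using (_≈_; _+_; _*_)
open Matrix-ℚ⟨x⟩ using (Matrix; det; _I-_; blockI; _^_)

private
  module ℚ[x] = CommutativeRing ℚ[x]
  module ℚ⟨x⟩ = CommutativeRing ℚ⟨x⟩

  ι-homo : IsRingHomomorphism ℚ[x].rawRing ℚ⟨x⟩.rawRing ι
  ι-homo = ι-isRingHomomorphism ℚ[x] ℚ[x]-isDomain

  α : Bool → ℚ⟨x⟩.Carrier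
  α b = ι (const (if b then 1ℚ else 0ℚ))

  -- Not definitional, in contrast to the case of `true`: `const 0ℚ` is a list with one zero
  -- coefficient, while the zero polynomial is the empty list.
  α-false : α false ≈ ℚ⟨x⟩.0#
  α-false = IsRingHomomorphism.⟦⟧-cong ι-homo (coeffwise λ { zero → ≡.refl ; (suc i) → ≡.refl })
    where open Polynomial ℚ.+-*-commutativeRing using (coeffwise)

-- Links the determinant over `ℚ[x]` that defines `f` to the ring in which the resolvent of H₁
-- exists.
f-fraction : (N : Matrix-ℚ.Matrix n) → ι (f N) ≈ det (x I- toℚ⟨x⟩ N)
f-fraction N = ℚ⟨x⟩.trans
  (det-homo ℚ[x] ℚ⟨x⟩ ι-homo (X Matrix-ℚ[x].I- λ i j → const (N i j)))
  (det-cong λ i j → ℚ⟨x⟩.trans (+-homo (X ℚ[x].* Matrix-ℚ[x].1ᴹ i j) (ℚ[x].- const (N i j)))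
    (ℚ⟨x⟩.+-cong
      (ℚ⟨x⟩.trans (*-homo X (Matrix-ℚ[x].1ᴹ i j)) (ℚ⟨x⟩.*-congˡ {x} (1ᴹ-homo ℚ[x] ℚ⟨x⟩ ι-homo i j)))
      (-‿homo (const (N i j)))))
  where
  open IsRingHomomorphism ι-homo
  open Determinant ℚ⟨x⟩ using (det-cong)

proposition3p1 : ∀ (n k h : ℕ) → 1 ≤ n → 2 ≤ suc h →
  (F : Graph n) (v : Fin k → Fin n) → Injective _≡_ _≡_ v →
  (H : Graph (suc h)) (u : Fin (suc h)) → degree H u ≡ h →
  (σ : Permutation′ n) → (∀ i → toℕ (σ ⟨$⟩ˡ v i) ≡ toℕ i) →
  let G = pockets F v H u
      H₁ = H ─ u
      M : Matrix n
      M = λ i j → toℚ⟨x⟩ (A (reorder σ F)) i j + Γ (A H₁) * blockI k i j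
  in ι (f (A G)) ≈ ι (f (A H₁)) ^ k * det (x I- M)
proposition3p1 n k h _ _ F v v-injective H u deg σ σv = ℚ⟨x⟩.trans
  (f-fraction (A (pockets F v H u)))
  (ℚ⟨x⟩.trans
    (det-pockets F v H u (dominating H u deg) (xI- A (H ─ u) ⁻¹) v-injective σ σv)
    (ℚ⟨x⟩.*-congʳ {det (x I- M)} (Exp.^-congˡ k (ℚ⟨x⟩.sym (f-fraction (A (H ─ u)))))))
  where
  M : Matrix n
  M i j = toℚ⟨x⟩ (A (reorder σ F)) i j + Γ (A (H ─ u)) * blockI k i j
  open Characteristic ℚ⟨x⟩ α ℚ⟨x⟩.refl α-false x using (det-pockets)
  module Exp = Algebra.Properties.Semiring.Exp ℚ⟨x⟩.semiring
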